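{- Let $\lambda$ be a positive integer and put $T_\lambda=\max(10^5,\,7\lambda+43)$. Every nontrivial graphical $t$-$\bigl(\binom{n}{2}, k, \lambda\bigr)$ design with $t \geq 2$ satisfies \[ t < 2.3\, T_\lambda^2,\qquad n < 4.7\, T_\lambda^2,\qquad\text{and}\qquad k < 11.1\, T_\lambda^4 . \]
   Context: For positive integers $t,\lambda$, an integer $k \ge t$ and a set $X$ of cardinality $v$, a $t$-$(v,k,\lambda)$ design is a pair $(X,\mathcal{B})$, where $\mathcal{B}$ is a finite multiset of $k$-subsets of $X$ such that every $t$-subset of $X$ is contained in exactly $\lambda$ members of $\mathcal{B}$, counted with multiplicity. The multiplicity of a $k$-subset $B$ in $\mathcal{B}$ is denoted $\mu_{\mathcal{B}}(B)$. The design is empty if $\mu_{\mathcal{B}}(B)=0$ for every $k$-subset $B$ of $X$; it contains the complete design if $\mu_{\mathcal{B}}(B)\ge 1$ for every $k$-subset $B$ of $X$. It is nontrivial if $t<k<v$ and it neither is empty nor contains the complete design. $V$ is an $n$-element set, $K_n$ is the complete graph with vertex set $V$, and $X=E(K_n)=\binom{V}{2}$ is the set of all $2$-subsets of $V$. The symmetric group $\mathrm{Sym}(V)$ acts on $X$ by $\sigma(\{x,y\})=\{\sigma(x),\sigma(y)\}$ and on subsets of $X$ elementwise. A $t$-$\bigl(\binom n2,k,\lambda\bigr)$ design on $X=E(K_n)$ is graphical if $\mu_{\mathcal{B}}(\sigma(B))=\mu_{\mathcal{B}}(B)$ for all $\sigma\in\mathrm{Sym}(V)$ and all $k$-subsets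 $B$ of $X$. -}

module Defs where

open import Algebra.Properties.CommutativeMonoid.Sum using (sum-permute)
open import Data.Bool.Base using (Bool; true; false)
import Data.Bool.Properties as Bool
open import Data.Fin.Base using (Fin)
open import Data.Fin.Permutation using (Permutation′; _⟨$⟩ʳ_; _⟨$⟩ˡ_; flip; cast-id; inverseˡ; inverseʳ)
open import Data.Fin.Properties using (+↔⊎)
open import Data.Fin.Subset using (Subset; inside; outside; ∣_∣)
open import Data.Fin.Subset.Properties using (_⊆?_)
open import Data.List.Base using (List; length; filter)
open import Data.Nat.Base using (ℕ; zero; suc; _+_; _*_; _^_; _⊔_; _≤_; _<_)
open import Data.Nat.Combinatorics using (_C_; nCk+nC[k+1]≡[n+1]C[k+1])
open import Data.Nat.Properties using (≡-irrelevant; suc-injective; +-0-commutativeMonoid)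
open import Data.Product.Base using (Σ-syntax; _×_; _,_; proj₁; proj₂)
open import Data.Sum.Base using (_⊎_; inj₁; inj₂)
open import Data.Sum.Function.Propositional using (_⊎-↔_)
open import Data.Vec.Base using ([]; _∷_; lookup; tabulate)
import Data.Vec.Functional as F
open import Data.Vec.Properties using (≡-dec; lookup∘tabulate; tabulate∘lookup; tabulate-cong)
open import Function.Bundles using (_↔_; mk↔ₛ′)
open import Function.Construct.Composition using (_↔-∘_)
open import Function.Construct.Symmetry using (↔-sym)
open import Relation.Binary.Definitions using (DecidableEquality)
open import Relation.Binary.PropositionalEquality
open import Relation.Nullary.Decidable using (map′)
open import Relation.Nullary.Negation using (¬_)

KSubset : ℕ → ℕ → Set
KSubset v k = Σ[ p ∈ Subset v ] ∣ p ∣ ≡ k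

KSubset-≡ : ∀ {v k} {P Q : KSubset v k} → proj₁ P ≡ proj₁ Q → P ≡ Q
KSubset-≡ {P = p , e} {Q = .p , e′} refl = cong (p ,_) (≡-irrelevant e e′)

_≟ₖ_ : ∀ {v k} → DecidableEquality (KSubset v k)
P ≟ₖ Q = map′ KSubset-≡ (cong proj₁) (≡-dec Bool._≟_ (proj₁ P) (proj₁ Q))

-- A point y lies in σ(p) exactly when σ⁻¹(y) lies in p.
image : ∀ {v} → Permutation′ v → Subset v → Subset v
image σ p = tabulate λ y → lookup p (σ ⟨$⟩ˡ y)

private
  +-sum : ∀ {n} → (Fin n → ℕ) → ℕ
  +-sum = F.foldr _+_ 0

  indicator : Bool → ℕ
  indicator true  = 1
  indicator false = 0

  ∣tabulate∣ : ∀ {n} (f : Fin n → Bool) → ∣ tabulate f ∣ ≡ +-sum (λ i → indicator (f i))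
  ∣tabulate∣ {zero}  f = refl
  ∣tabulate∣ {suc n} f with f Fin.zero
  ... | true  = cong suc (∣tabulate∣ (λ i → f (Fin.suc i)))
  ... | false = ∣tabulate∣ (λ i → f (Fin.suc i))

∣image∣ : ∀ {v} (σ : Permutation′ v) (p : Subset v) → ∣ image σ p ∣ ≡ ∣ p ∣
∣image∣ σ p = begin
  ∣ image σ p ∣                                 ≡⟨ ∣tabulate∣ (λ y → lookup p (σ ⟨$⟩ˡ y)) ⟩
  +-sum (λ y → indicator (lookup p (σ ⟨$⟩ˡ y))) ≡⟨ sum-permute +-0-commutativeMonoid (λ i → indicator (lookup p i)) (flip σ) ⟨
  +-sum (λ i → indicator (lookup p i))          ≡⟨ ∣tabulate∣ (lookup p) ⟨
  ∣ tabulate (lookup p) ∣                       ≡⟨ cong ∣_∣ (tabulate∘lookup p) ⟩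
  ∣ p ∣                                         ∎
  where open ≡-Reasoning

imageₖ : ∀ {v k} → Permutation′ v → KSubset v k → KSubset v k
imageₖ σ (p , ∣p∣≡k) = image σ p , trans (∣image∣ σ p) ∣p∣≡k

image-flip : ∀ {v} (σ : Permutation′ v) (p : Subset v) → image σ (image (flip σ) p) ≡ p
image-flip σ p = trans
  (tabulate-cong λ y → trans (lookup∘tabulate _ (σ ⟨$⟩ˡ y)) (cong (lookup p) (inverseʳ σ)))
  (tabulate∘lookup p)

flip-image : ∀ {v} (σ : Permutation′ v) (p : Subset v) → image (flip σ) (image σ p) ≡ p
flip-image σ p = trans
  (tabulate-cong λ y → trans (lookup∘tabulate _ (σ ⟨$⟩ʳ y)) (cong (lookup p) (inverseˡ σ)))
  (tabulate∘lookup p)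

imageₖ-↔ : ∀ {v k} → Permutation′ v → KSubset v k ↔ KSubset v k
imageₖ-↔ σ = mk↔ₛ′ (imageₖ σ) (imageₖ (flip σ))
  (λ P → KSubset-≡ (image-flip σ (proj₁ P)))
  (λ P → KSubset-≡ (flip-image σ (proj₁ P)))

private
  split : ∀ n k → KSubset (suc n) (suc k) ↔ (KSubset n k ⊎ KSubset n (suc k))
  split n k = mk↔ₛ′ to from to∘from from∘to
    where
    to : KSubset (suc n) (suc k) → KSubset n k ⊎ KSubset n (suc k)
    to (inside  ∷ p , e) = inj₁ (p , suc-injective e)
    to (outside ∷ p , e) = inj₂ (p , e)

    from : KSubset n k ⊎ KSubset n (suc k) → KSubset (suc n) (suc k)
    from (inj₁ (p , e)) = inside ∷ p , cong suc e
    from (inj₂ (p , e)) = outside ∷ p , e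

    to∘from : ∀ s → to (from s) ≡ s
    to∘from (inj₁ _) = cong inj₁ (KSubset-≡ refl)
    to∘from (inj₂ _) = refl

    from∘to : ∀ P → from (to P) ≡ P
    from∘to (inside  ∷ _ , _) = KSubset-≡ refl
    from∘to (outside ∷ _ , _) = refl

  skip : ∀ n → KSubset (suc n) 0 ↔ KSubset n 0
  skip n = mk↔ₛ′
    (λ { (outside ∷ p , e) → p , e })
    (λ { (p , e) → outside ∷ p , e })
    (λ _ → refl)
    (λ { (outside ∷ _ , _) → refl })

-- Labels the k-subsets of an n-element set by Fin (n C k), so that they can in
-- turn serve as the points of a design.
enumerate : ∀ n k → KSubset n k ↔ Fin (n C k)
enumerate zero    zero    = mk↔ₛ′ (λ _ → Fin.zero) (λ _ → [] , refl)
                              (λ { Fin.zero → refl ; (Fin.suc ()) }) (λ { ([] , refl) → refl })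
enumerate zero    (suc k) = mk↔ₛ′ (λ { ([] , ()) }) (λ ()) (λ ()) (λ { ([] , ()) })
enumerate (suc n) zero    = enumerate n zero ↔-∘ skip n
enumerate (suc n) (suc k) =
  cast-id (nCk+nC[k+1]≡[n+1]C[k+1] n k) ↔-∘ (↔-sym +↔⊎ ↔-∘
    ((enumerate n k ⊎-↔ enumerate n (suc k)) ↔-∘ split n k))

Edge : ℕ → Set
Edge n = KSubset n 2

edges : ∀ n → Edge n ↔ Fin (n C 2)
edges n = enumerate n 2

-- The action of σ on edges, σ{x,y} = {σx,σy}, read on the labels of the edges.
onEdges : ∀ {n} → Permutation′ n → Permutation′ (n C 2)
onEdges {n} σ = edges n ↔-∘ (imageₖ-↔ σ ↔-∘ ↔-sym (edges n))

-- The v-set of points is Fin v.  A finite multiset of blocks is given by a list;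
-- only multiplicities and counts of its members are ever used, so the order of
-- the list is irrelevant.
record Design (t v k lam : ℕ) : Set where
  field
    1≤t      : 1 ≤ t
    1≤lam    : 1 ≤ lam
    t≤k      : t ≤ k
    blocks   : List (KSubset v k)
    balanced : (S : KSubset v t) →
               length (filter (λ B → proj₁ S ⊆? proj₁ B) blocks) ≡ lam

  μ : KSubset v k → ℕ
  μ B = length (filter (B ≟ₖ_) blocks)

  IsEmpty : Set
  IsEmpty = ∀ B → μ B ≡ 0

  ContainsComplete : Set
  ContainsComplete = ∀ B → 1 ≤ μ B

  Nontrivial : Set
  Nontrivial = t < k × k < v × ¬ IsEmpty × ¬ ContainsComplete

Graphical : ∀ {n t k lam} → Design t (n C 2) k lam → Set
Graphical {n} D = ∀ (σ : Permutation′ n) B → μ (imageₖ (onEdges σ) B) ≡ μ B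
  where open Design D

T : ℕ → ℕ
T lam = 10 ^ 5 ⊔ (7 * lam + 43)

{-# OPTIONS --safe #-}

-- A design with k + t ≥ v has constant multiplicities (inclusion–exclusion on
-- the complement of a block), so a nontrivial one has 2t < v.  If B is a block
-- containing a t-edge graph G, and y, z belong to a set of more than λ + 3
-- vertices on which all transpositions fix G, then y and z are twins in B:
-- otherwise these transpositions would yield more than λ blocks through G.
--
-- Suppose n ≥ 2 T λ.  Choose N so that the edges leaving {0, …, N − 1} (the outer
-- ones) together with between 2 and N further edges number exactly t; then N > n/2.
-- Let S consist of the outer edges and a few-vertex graph on {0, …, N − 1} that has
-- three leaves and is not contained in a star, and let B ⊇ S be a block.  The many
-- vertices isolated in S are twins in B.  If they are still isolated in B, trading
-- the edge at a leaf of S for an edge of B ∖ S makes that leaf a twin of them, which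
-- is absurd.  Otherwise some x is joined to all of them; trading the edges of S at
-- a vertex y ≠ x for edges from x makes y a twin of them as well.  As S is no star,
-- B is then the complete graph, contradicting k < v.  So n < 2 T λ, and the
-- bounds follow from t < k < v ≤ n²/2.
module Submission where

open import Defs
open import Data.Bool.Base using (Bool; true; false; not; _∨_; if_then_else_)
import Data.Bool.Properties as Bool
open import Data.Empty using (⊥)
open import Data.Fin.Base using (Fin; zero; suc; toℕ; fromℕ<; opposite; punchIn; remQuot; combine)
open import Data.Fin.Permutation using (Permutation′; _⟨$⟩ʳ_; _⟨$⟩ˡ_; flip; inverseˡ; inverseʳ; reverse; transpose)
import Data.Fin.Properties as Fin
open import Data.Fin.Subset using (Subset; ∣_∣; ∁; _⊆_) renaming (⊥ to ∅; ⊤ to full)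
open import Data.Fin.Subset.Properties using (_⊆?_; p⊆q⇒∣p∣≤∣q∣; p⊂q⇒∣p∣<∣q∣; ∣p∣≤n; ∣⊥∣≡0; ∣⊤∣≡n; ∣∁p∣≡n∸∣p∣)
open import Data.List.Base using (List; []; _∷_; length; filter)
open import Data.List.Membership.Propositional using (_∈_)
open import Data.List.Membership.Propositional.Properties using (∈-filter⁺; ∈-filter⁻)
open import Data.List.Membership.Setoid.Properties using (index-injective)
open import Data.List.Properties using (filter-≐; filter-some)
open import Data.List.Relation.Unary.Any using (here; index)
open import Data.Nat.Base using (ℕ; zero; suc; _+_; _*_; _^_; _∸_; _≤_; _<_; z≤n; s≤s; s≤s⁻¹; _≤′_; ≤′-refl; ≤′-step; NonZero; >-nonZero)
open import Data.Nat.Combinatorics using (_C_; nC1≡n; nCk+nC[k+1]≡[n+1]C[k+1])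
open import Data.Nat.DivMod using (_/_; _%_; m*n/n≡m; m≡m%n+[m/n]*n; m%n<n; m/n*n≤m)
open import Data.Nat.Properties
open import Algebra.Properties.CommutativeMonoid.Sum +-0-commutativeMonoid using (∑-distrib-+; sum-cong-≗; sum-replicate-zero) renaming (sum to ∑)
open import Algebra.Properties.CommutativeSemigroup +-commutativeSemigroup using (interchange)
open import Data.Nat.Tactic.RingSolver using (solve-∀)
open import Data.Product.Base using (Σ-syntax; ∃-syntax; _×_; _,_; _,′_; proj₁; proj₂; uncurry)
open import Data.Sum.Base using (_⊎_; inj₁; inj₂; [_,_]′) renaming (swap to ⊎-swap)
open import Data.Unit.Base using (⊤; tt)
open import Data.Vec.Base using ([]; _∷_; lookup; tabulate; _[_]≔_)
open import Data.Vec.Properties using (lookup∘update; lookup∘update′; lookup∘tabulate; tabulate∘lookup; tabulate-cong; lookup-map; lookup-replicate; lookup⇒[]=; []=⇒lookup; []≔-idempotent; []≔-commutes; []≔-lookup)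
open import Function.Base using (_∘_; case_of_)
open import Function.Bundles using (Inverse; mk⇔)
open import Function.Definitions using (Injective)
open import Relation.Binary.PropositionalEquality
open import Relation.Nullary.Decidable using (Dec; yes; no; does; does-⇔; dec-true; dec-false; map′; _×-dec_; _⊎-dec_; _→-dec_)
open import Relation.Nullary.Negation using (¬_; contradiction)
open import Relation.Unary using (Decidable)

private
  variable
    v k m n : ℕ

-- Subsets as Boolean vectors: sizes, exchanges, interpolation.

_∋_ : Subset v → Fin v → Set
p ∋ e = lookup p e ≡ true

_∌_ : Subset v → Fin v → Set
p ∌ e = lookup p e ≡ false

_⊑_ : Subset v → Subset v → Set
p ⊑ q = ∀ e → p ∋ e → q ∋ e

¬∋⇒∌ : ∀ (p : Subset v) {e} → ¬ (p ∋ e) → p ∌ e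
¬∋⇒∌ p = Bool.¬-not

∋∌-absurd : ∀ (p : Subset v) {e} {A : Set} → p ∋ e → p ∌ e → A
∋∌-absurd p p∋e p∌e with () ← trans (sym p∋e) p∌e

⊑⇒⊆ : ∀ (p q : Subset v) → p ⊑ q → p ⊆ q
⊑⇒⊆ p q p⊑q {x} x∈p = lookup⇒[]= x q (p⊑q x ([]=⇒lookup x∈p))

⊆⇒⊑ : ∀ (p q : Subset v) → p ⊆ q → p ⊑ q
⊆⇒⊑ p q p⊆q e p∋e = []=⇒lookup (p⊆q (lookup⇒[]= e p p∋e))

⊑⇒∣∣≤ : ∀ (p q : Subset v) → p ⊑ q → ∣ p ∣ ≤ ∣ q ∣
⊑⇒∣∣≤ p q p⊑q = p⊆q⇒∣p∣≤∣q∣ (⊑⇒⊆ p q p⊑q)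

subset-ext : {p q : Subset v} → (∀ e → lookup p e ≡ lookup q e) → p ≡ q
subset-ext {p = p} {q} eq = trans (sym (tabulate∘lookup p)) (trans (tabulate-cong eq) (tabulate∘lookup q))

∣insert∣ : ∀ (p : Subset v) e → p ∌ e → ∣ p [ e ]≔ true ∣ ≡ suc ∣ p ∣
∣insert∣ (false ∷ p) zero    _   = refl
∣insert∣ (true  ∷ p) (suc e) p∌e = cong suc (∣insert∣ p e p∌e)
∣insert∣ (false ∷ p) (suc e) p∌e = ∣insert∣ p e p∌e

∣insert∣≤ : ∀ (p : Subset v) e → ∣ p [ e ]≔ true ∣ ≤ suc ∣ p ∣
∣insert∣≤ (true  ∷ p) zero    = n≤1+n _
∣insert∣≤ (false ∷ p) zero    = ≤-refl
∣insert∣≤ (true  ∷ p) (suc e) = s≤s (∣insert∣≤ p e)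
∣insert∣≤ (false ∷ p) (suc e) = ∣insert∣≤ p e

∣delete∣ : ∀ (p : Subset v) e → p ∋ e → suc ∣ p [ e ]≔ false ∣ ≡ ∣ p ∣
∣delete∣ (true  ∷ p) zero    _   = refl
∣delete∣ (true  ∷ p) (suc e) p∋e = cong suc (∣delete∣ p e p∋e)
∣delete∣ (false ∷ p) (suc e) p∋e = ∣delete∣ p e p∋e

exchange : Subset v → Fin v → Fin v → Subset v
exchange p a b = (p [ a ]≔ false) [ b ]≔ true

module _ (p : Subset v) {a b : Fin v} (p∋a : p ∋ a) (p∌b : p ∌ b) where

  private
    b≢a : b ≢ a
    b≢a refl = ∋∌-absurd p p∋a p∌b

  ∣exchange∣ : ∣ exchange p a b ∣ ≡ ∣ p ∣
  ∣exchange∣ = trans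
    (∣insert∣ (p [ a ]≔ false) b (trans (lookup∘update′ b≢a p false) p∌b))
    (∣delete∣ p a p∋a)

  exchange-out : exchange p a b ∌ a
  exchange-out = trans (lookup∘update′ (b≢a ∘ sym) (p [ a ]≔ false) true) (lookup∘update a p false)

exchange-else : ∀ (p : Subset v) {a b e} → e ≢ a → e ≢ b → lookup (exchange p a b) e ≡ lookup p e
exchange-else p e≢a e≢b = trans (lookup∘update′ e≢b (p [ _ ]≔ false) true) (lookup∘update′ e≢a p false)

exchange-⊑ : ∀ (p q : Subset v) {a b} → p ⊑ q → q ∋ b → exchange p a b ⊑ q
exchange-⊑ p q {a} {b} p⊑q q∋b e ∋e with e Fin.≟ b | e Fin.≟ a
... | yes refl | _        = q∋b
... | no e≢b   | yes refl =
  contradiction (trans (sym ∋e) (trans (lookup∘update′ e≢b (p [ a ]≔ false) true) (lookup∘update a p false))) λ ()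
... | no e≢b   | no e≢a   = p⊑q e (trans (sym (exchange-else p e≢a e≢b)) ∋e)

-- An optional point is left out as long as the rest of `q` still has `t` elements. Once it does
-- not, `t` equals the full size, and everything that remains is taken.
between : ∀ (p q : Subset v) t → p ⊑ q → ∣ p ∣ ≤ t → t ≤ ∣ q ∣ →
          ∃[ r ] p ⊑ r × r ⊑ q × ∣ r ∣ ≡ t
between [] [] .0 _ z≤n z≤n = [] , (λ ()) , (λ ()) , refl
between (true ∷ p) (false ∷ q) t p⊑q _ _ with () ← p⊑q zero refl
between (true ∷ p) (true ∷ q) (suc t) p⊑q (s≤s l) (s≤s u)
  with r , p⊑r , r⊑q , ∣r∣ ← between p q t (p⊑q ∘ suc) l u
  = true ∷ r , (λ { zero _ → refl ; (suc e) → p⊑r e }) , (λ { zero _ → refl ; (suc e) → r⊑q e }) , cong suc ∣r∣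
between (false ∷ p) (false ∷ q) t p⊑q l u
  with r , p⊑r , r⊑q , ∣r∣ ← between p q t (p⊑q ∘ suc) l u
  = false ∷ r , (λ { zero () ; (suc e) → p⊑r e }) , (λ { zero () ; (suc e) → r⊑q e }) , ∣r∣
between (false ∷ p) (true ∷ q) t p⊑q l u with t ≤? ∣ q ∣
... | yes t≤∣q∣ with r , p⊑r , r⊑q , ∣r∣ ← between p q t (p⊑q ∘ suc) l t≤∣q∣
  = false ∷ r , (λ { zero () ; (suc e) → p⊑r e }) , (λ { zero () ; (suc e) → r⊑q e }) , ∣r∣
... | no t≰∣q∣ = true ∷ q , (λ { zero () ; (suc e) → p⊑q (suc e) }) , (λ _ ∋e → ∋e) , ≤-antisym (≰⇒> t≰∣q∣) u

-- The values of `f` are inserted into `p` one at a time. Each raises the size by at most one, so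
-- repeated values do no harm.
∣∣-upper : ∀ {m} (p q : Subset v) (f : Fin m → Fin v) →
           (∀ e → q ∋ e → p ∋ e ⊎ ∃[ i ] f i ≡ e) → ∣ q ∣ ≤ m + ∣ p ∣
∣∣-upper {m = zero} p q f cover = ⊑⇒∣∣≤ q p λ e q∋e → case cover e q∋e of λ where
  (inj₁ p∋e) → p∋e
∣∣-upper {m = suc m} p q f cover = ≤-trans
  (∣∣-upper (p [ f zero ]≔ true) q (f ∘ suc) cover′)
  (≤-trans (+-monoʳ-≤ m (∣insert∣≤ p (f zero))) (≤-reflexive (+-suc m ∣ p ∣)))
  where
  cover′ : ∀ e → q ∋ e → (p [ f zero ]≔ true) ∋ e ⊎ ∃[ i ] f (suc i) ≡ e
  cover′ e q∋e with e Fin.≟ f zero | cover e q∋e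
  ... | yes refl | _                    = inj₁ (lookup∘update e p true)
  ... | no e≢    | inj₁ p∋e             = inj₁ (trans (lookup∘update′ e≢ p true) p∋e)
  ... | no e≢    | inj₂ (zero , refl)   = contradiction refl e≢
  ... | no e≢    | inj₂ (suc i , fi≡e)  = inj₂ (i , fi≡e)

∣∣-lower : ∀ {m} (p q : Subset v) (f : Fin m → Fin v) → Injective _≡_ _≡_ f → p ⊑ q →
           (∀ i → p ∌ f i) → (∀ i → q ∋ f i) → m + ∣ p ∣ ≤ ∣ q ∣
∣∣-lower {m = zero}  p q f inj p⊑q out inn = ⊑⇒∣∣≤ p q p⊑q
∣∣-lower {m = suc m} p q f inj p⊑q out inn = ≤-trans
  (≤-reflexive (trans (sym (+-suc m ∣ p ∣)) (cong (m +_) (sym (∣insert∣ p (f zero) (out zero))))))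
  (∣∣-lower (p [ f zero ]≔ true) q (f ∘ suc) (Fin.suc-injective ∘ inj) p′⊑q
    (λ i → trans (lookup∘update′ (λ eq → contradiction (inj eq) λ ()) p true) (out (suc i)))
    (inn ∘ suc))
  where
  p′⊑q : (p [ f zero ]≔ true) ⊑ q
  p′⊑q e ∋e with e Fin.≟ f zero
  ... | yes refl = inn zero
  ... | no e≢    = p⊑q e (trans (sym (lookup∘update′ e≢ p true)) ∋e)

new-element : ∀ (p q : Subset v) → ∣ p ∣ < ∣ q ∣ → ∃[ e ] q ∋ e × p ∌ e
new-element p q ∣p∣<∣q∣ with Fin.any? (λ e → (lookup q e Bool.≟ true) ×-dec (lookup p e Bool.≟ false))
... | yes found = found
... | no  none  = contradiction (⊑⇒∣∣≤ q p q⊑p) (<⇒≱ ∣p∣<∣q∣)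
  where
  q⊑p : q ⊑ p
  q⊑p e q∋e = Bool.¬-not λ p∌e → none (e , q∋e , p∌e)

⊑∧∣∣⇒≡ : ∀ (p q : Subset v) → p ⊑ q → ∣ p ∣ ≡ ∣ q ∣ → p ≡ q
⊑∧∣∣⇒≡ p q p⊑q eq = subset-ext λ e → helper e
  where
  helper : ∀ e → lookup p e ≡ lookup q e
  helper e with lookup q e in q? | lookup p e in p?
  ... | true  | true  = refl
  ... | false | false = refl
  ... | false | true  = ∋∌-absurd q (p⊑q e p?) q?
  ... | true  | false = contradiction
    (p⊂q⇒∣p∣<∣q∣ (⊑⇒⊆ p q p⊑q , e , lookup⇒[]= e q q? , λ e∈p → ∋∌-absurd p ([]=⇒lookup e∈p) p?))
    (<-irrefl eq)

member : ∀ (p : Subset v) {m} → ∣ p ∣ ≡ suc m → ∃[ e ] p ∋ e × ∣ p [ e ]≔ false ∣ ≡ m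
member (true  ∷ p) eq = zero , refl , suc-injective eq
member (false ∷ p) eq with e , p∋e , eq′ ← member p eq = suc e , p∋e , eq′

∣∣≡0⇒∅ : ∀ (p : Subset v) → ∣ p ∣ ≡ 0 → p ≡ ∅
∣∣≡0⇒∅ []          _  = refl
∣∣≡0⇒∅ (false ∷ p) eq = cong (false ∷_) (∣∣≡0⇒∅ p eq)

-- Distinct values sit at distinct positions. In `too-many` this bounds the number of different
-- blocks through a given graph.
injection-into-list : ∀ {A : Set} {f : Fin m → A} (xs : List A) →
                      Injective _≡_ _≡_ f → (∀ i → f i ∈ xs) → m ≤ length xs
injection-into-list xs inj f∈xs =
  Fin.injective⇒≤ {f = λ i → index (f∈xs i)} λ {i} {j} eq →
    inj (index-injective (setoid _) (f∈xs i) (f∈xs j) eq)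

-- Counting blocks that contain one set and avoid another.

abstract
  _⊑?_ : ∀ (p q : Subset v) → Dec (p ⊑ q)
  p ⊑? q = map′ (⊆⇒⊑ p q) (⊑⇒⊆ p q) (p ⊆? q)

Avoids : Subset v → Subset v → Set
Avoids p q = ∀ e → p ∋ e → q ∌ e

avoids? : ∀ (p q : Subset v) → Dec (Avoids p q)
avoids? p q = Fin.all? λ e → (lookup p e Bool.≟ true) →-dec (lookup q e Bool.≟ false)

insert-⊑ : ∀ (p q : Subset v) e → p ⊑ q → q ∋ e → (p [ e ]≔ true) ⊑ q
insert-⊑ p q e p⊑q q∋e e′ ∋e′ with e′ Fin.≟ e
... | yes refl = q∋e
... | no e′≢e  = p⊑q e′ (trans (sym (lookup∘update′ e′≢e p true)) ∋e′)

insert-⊒ : ∀ (p q : Subset v) e → (p [ e ]≔ true) ⊑ q → p ⊑ q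
insert-⊒ p q e p′⊑q e′ p∋e′ with e′ Fin.≟ e
... | yes refl = p′⊑q e (lookup∘update e p true)
... | no e′≢e  = p′⊑q e′ (trans (lookup∘update′ e′≢e p true) p∋e′)

private
  delete-⊑ : ∀ (p : Subset v) e → (p [ e ]≔ false) ⊑ p
  delete-⊑ p e e′ ∋e′ with e′ Fin.≟ e
  ... | yes refl = contradiction (trans (sym ∋e′) (lookup∘update e p false)) λ ()
  ... | no e′≢e  = trans (sym (lookup∘update′ e′≢e p false)) ∋e′

  undelete-avoids : ∀ (p q : Subset v) e → Avoids (p [ e ]≔ false) q → q ∌ e → Avoids p q
  undelete-avoids p q e av q∌e e′ p∋e′ with e′ Fin.≟ e
  ... | yes refl = q∌e
  ... | no e′≢e  = av e′ (trans (lookup∘update′ e′≢e p false) p∋e′)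

module _ {A : Set} {P Q R : A → Set} (P? : Decidable P) (Q? : Decidable Q) (R? : Decidable R)
         (P⇒Q⊎R : ∀ {x} → P x → Q x ⊎ R x) (Q⇒P : ∀ {x} → Q x → P x) (R⇒P : ∀ {x} → R x → P x)
         (¬QR : ∀ {x} → Q x → ¬ R x) where

  length-filter-⊎ : ∀ xs → length (filter P? xs) ≡ length (filter Q? xs) + length (filter R? xs)
  length-filter-⊎ []       = refl
  length-filter-⊎ (x ∷ xs) with P? x | Q? x | R? x
  ... | yes _ | yes q | yes r = contradiction r (¬QR q)
  ... | yes _ | yes _ | no _  = cong suc (length-filter-⊎ xs)
  ... | yes _ | no _  | yes _ = trans (cong suc (length-filter-⊎ xs)) (sym (+-suc _ _))
  ... | yes p | no ¬q | no ¬r = case P⇒Q⊎R p of λ where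
    (inj₁ q) → contradiction q ¬q
    (inj₂ r) → contradiction r ¬r
  ... | no ¬p | yes q | _     = contradiction (Q⇒P q) ¬p
  ... | no ¬p | no _  | yes r = contradiction (R⇒P r) ¬p
  ... | no _  | no _  | no _  = length-filter-⊎ xs

private
  ⟦_⟧ : Bool → ℕ
  ⟦ b ⟧ = if b then 1 else 0

  ∣∣≡∑ : ∀ (p : Subset v) → ∣ p ∣ ≡ ∑ (λ x → ⟦ lookup p x ⟧)
  ∣∣≡∑ []          = refl
  ∣∣≡∑ (true  ∷ p) = cong suc (∣∣≡∑ p)
  ∣∣≡∑ (false ∷ p) = ∣∣≡∑ p

  ∑-outside : ∀ (p : Subset v) c → ∑ (λ x → if lookup p x then 0 else c) + ∣ p ∣ * c ≡ v * c
  ∑-outside []          c = refl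
  ∑-outside {suc v} (true ∷ p) c = begin
    s + (c + ∣ p ∣ * c) ≡⟨ +-comm s _ ⟩
    (c + ∣ p ∣ * c) + s ≡⟨ +-assoc c _ s ⟩
    c + (∣ p ∣ * c + s) ≡⟨ cong (c +_) (trans (+-comm _ s) (∑-outside p c)) ⟩
    c + v * c           ∎
    where
    open ≡-Reasoning
    s = ∑ (λ x → if lookup p x then 0 else c)
  ∑-outside (false ∷ p) c = trans (+-assoc c _ _) (cong (c +_) (∑-outside p c))

  containing : Subset v → List (KSubset v k) → ℕ
  containing I xs = length (filter (λ B → I ⊑? proj₁ B) xs)

  -- Points of `I` count zero, so the sum over all `v` points counts the pairs of a block through
  -- `I` and a point of that block outside `I`.
  extensions : Subset v → List (KSubset v k) → Fin v → ℕ
  extensions I xs x = if lookup I x then 0 else containing (I [ x ]≔ true) xs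

  extensions-∷ : ∀ (I : Subset v) (B : KSubset v k) xs x →
    extensions I (B ∷ xs) x ≡ extensions I (B ∷ []) x + extensions I xs x
  extensions-∷ I B xs x with lookup I x
  ... | true  = refl
  ... | false with does ((I [ x ]≔ true) ⊑? proj₁ B)
  ...   | true  = refl
  ...   | false = refl

  extensions-⊑ : ∀ (I : Subset v) (B : KSubset v k) x → I ⊑ proj₁ B →
    extensions I (B ∷ []) x + ⟦ lookup I x ⟧ ≡ ⟦ lookup (proj₁ B) x ⟧
  extensions-⊑ I (B , _) x I⊑B with lookup I x in I?
  ... | true rewrite I⊑B x I? = refl
  ... | false with (I [ x ]≔ true) ⊑? B | lookup B x in B?
  ...   | yes _   | true  = refl
  ...   | yes I′⊑ | false = contradiction (trans (sym (I′⊑ x (lookup∘update x I true))) B?) λ ()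
  ...   | no ¬I′⊑ | true  = contradiction (insert-⊑ I B x I⊑B B?) ¬I′⊑
  ...   | no _    | false = refl

  extensions-⋢ : ∀ (I : Subset v) (B : KSubset v k) x → ¬ I ⊑ proj₁ B → extensions I (B ∷ []) x ≡ 0
  extensions-⋢ I (B , _) x I⋢B with lookup I x
  ... | true = refl
  ... | false with (I [ x ]≔ true) ⊑? B
  ...   | yes I′⊑ = contradiction (insert-⊒ I B x I′⊑) I⋢B
  ...   | no _    = refl

  -- Double counting: each block through `I` has `k` minus `∣ I ∣` points outside `I`. The
  -- subtracted term is moved to the left to avoid truncation.
  ∑-extensions : ∀ (I : Subset v) (xs : List (KSubset v k)) →
    ∑ (extensions I xs) + ∣ I ∣ * containing I xs ≡ k * containing I xs
  ∑-extensions {v} {k} I [] = trans (cong₂ _+_ (trans (sum-cong-≗ zeros) (sum-replicate-zero v)) (*-zeroʳ ∣ I ∣)) (sym (*-zeroʳ k))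
    where
    zeros : ∀ x → extensions {k = k} I [] x ≡ 0
    zeros x with lookup I x
    ... | true  = refl
    ... | false = refl
  ∑-extensions {v} {k} I (B ∷ xs) = begin
    ∑ (extensions I (B ∷ xs)) + ∣ I ∣ * containing I (B ∷ xs)
      ≡⟨ cong (_+ ∣ I ∣ * containing I (B ∷ xs)) (trans (sum-cong-≗ (extensions-∷ I B xs)) (∑-distrib-+ (extensions I (B ∷ [])) _)) ⟩
    (∑ (extensions I (B ∷ [])) + ∑ (extensions I xs)) + ∣ I ∣ * containing I (B ∷ xs)
      ≡⟨ step ⟩
    k * containing I (B ∷ xs) ∎
    where
    open ≡-Reasoning
    s₁ = ∑ (extensions I (B ∷ []))
    s = ∑ (extensions I xs)
    step : (s₁ + s) + ∣ I ∣ * containing I (B ∷ xs) ≡ k * containing I (B ∷ xs)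
    step with I ⊑? proj₁ B
    ... | yes I⊑B = begin
      (s₁ + s) + ∣ I ∣ * suc c       ≡⟨ cong ((s₁ + s) +_) (*-suc ∣ I ∣ c) ⟩
      (s₁ + s) + (∣ I ∣ + ∣ I ∣ * c) ≡⟨ interchange s₁ s ∣ I ∣ _ ⟩
      (s₁ + ∣ I ∣) + (s + ∣ I ∣ * c) ≡⟨ cong₂ _+_ s₁+∣I∣ (∑-extensions I xs) ⟩
      k + k * c                      ≡⟨ *-suc k c ⟨
      k * suc c                      ∎
      where
      c = containing I xs
      s₁+∣I∣ : s₁ + ∣ I ∣ ≡ k
      s₁+∣I∣ = begin
        s₁ + ∣ I ∣ ≡⟨ cong (s₁ +_) (∣∣≡∑ I) ⟩
        s₁ + ∑ (λ x → ⟦ lookup I x ⟧) ≡⟨ ∑-distrib-+ (extensions I (B ∷ [])) _ ⟨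
        ∑ (λ x → extensions I (B ∷ []) x + ⟦ lookup I x ⟧)
          ≡⟨ sum-cong-≗ (λ x → extensions-⊑ I B x I⊑B) ⟩
        ∑ (λ x → ⟦ lookup (proj₁ B) x ⟧) ≡⟨ ∣∣≡∑ (proj₁ B) ⟨
        ∣ proj₁ B ∣ ≡⟨ proj₂ B ⟩
        k ∎
    ... | no I⋢B = trans (cong (λ z → (z + s) + ∣ I ∣ * containing I xs) s₁≡0) (∑-extensions I xs)
      where
      s₁≡0 : s₁ ≡ 0
      s₁≡0 = trans (sum-cong-≗ (λ x → extensions-⋢ I B x I⋢B))
                   (sum-replicate-zero v)

module _ {v k : ℕ} (xs : List (KSubset v k)) where

  Balanced : ℕ → Set
  Balanced i = ∃[ c ] ∀ I → ∣ I ∣ ≡ i → containing I xs ≡ c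

  -- With `suc d` equal to `k - i`, double counting gives `suc d * N + i * c ≡ v * c` for the number
  -- `N` of blocks through an `i`-set. This determines `N`, and the division is exact.
  balanced-pred : ∀ {i} → i < k → Balanced (suc i) → Balanced i
  balanced-pred {i} i<k (c , const) with d , 1+i+d≡k ← m≤n⇒∃[o]m+o≡n i<k
    = (v * c ∸ i * c) / suc d , solve
    where
    open ≡-Reasoning
    solve : ∀ I → ∣ I ∣ ≡ i → containing I xs ≡ (v * c ∸ i * c) / suc d
    solve I refl = begin
      N                                ≡⟨ m*n/n≡m N (suc d) ⟨
      (N * suc d) / suc d              ≡⟨ cong (_/ suc d) (trans (*-comm N (suc d)) (sym s≡)) ⟩
      s / suc d                        ≡⟨ cong (_/ suc d) (m+n∸n≡m s (i * c)) ⟨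
      (s + i * c ∸ i * c) / suc d      ≡⟨ cong (λ z → (z ∸ i * c) / suc d) s+ic ⟩
      (v * c ∸ i * c) / suc d          ∎
      where
      N = containing I xs
      s = ∑ (extensions I xs)
      s≡ : s ≡ suc d * N
      s≡ = +-cancelʳ-≡ (i * N) s (suc d * N) (begin
        s + i * N               ≡⟨ ∑-extensions I xs ⟩
        k * N                   ≡⟨ cong (_* N) (trans (sym 1+i+d≡k) (cong suc (+-comm i d))) ⟩
        (suc d + i) * N         ≡⟨ *-distribʳ-+ N (suc d) i ⟩
        suc d * N + i * N       ∎)
      ext≡ : ∀ x → extensions I xs x ≡ (if lookup I x then 0 else c)
      ext≡ x with lookup I x in I?
      ... | true  = refl
      ... | false = const (I [ x ]≔ true) (∣insert∣ I x I?)
      s+ic : s + i * c ≡ v * c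
      s+ic = trans (cong (_+ i * c) (sum-cong-≗ ext≡)) (∑-outside I c)

  balanced-≤ : ∀ {i t} → t ≤ k → i ≤′ t → Balanced t → Balanced i
  balanced-≤ t≤k ≤′-refl        bal = bal
  balanced-≤ t≤k (≤′-step i≤′t) bal = balanced-≤ (<⇒≤ t≤k) i≤′t (balanced-pred t≤k bal)

  separating : Subset v → Subset v → ℕ
  separating I J = length (filter (λ B → (I ⊑? proj₁ B) ×-dec avoids? J (proj₁ B)) xs)

  -- Inclusion–exclusion, one point of J at a time.
  separating-const : ∀ {t} → t ≤ k → Balanced t → ∀ i j → i + j ≤ t →
    ∃[ c ] ∀ I J → Avoids I J → ∣ I ∣ ≡ i → ∣ J ∣ ≡ j → separating I J ≡ c
  separating-const t≤k bal i zero i≤t = proj₁ bal-i , λ I J _ ∣I∣≡i ∣J∣≡0 →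
      trans (cong length (filter-≐ _ (λ B → I ⊑? proj₁ B) (equiv I J ∣J∣≡0) xs)) (proj₂ bal-i I ∣I∣≡i)
    where
    bal-i : Balanced i
    bal-i = balanced-≤ t≤k (≤⇒≤′ (≤-trans (m≤m+n i 0) i≤t)) bal
    equiv : ∀ I J → ∣ J ∣ ≡ 0 →
            (∀ {B : KSubset v k} → I ⊑ proj₁ B × Avoids J (proj₁ B) → I ⊑ proj₁ B) ×
            (∀ {B : KSubset v k} → I ⊑ proj₁ B → I ⊑ proj₁ B × Avoids J (proj₁ B))
    equiv I J ∣J∣≡0 = proj₁ , λ I⊑B → I⊑B , λ e J∋e →
      contradiction (trans (sym J∋e) (trans (cong (λ p → lookup p e) (∣∣≡0⇒∅ J ∣J∣≡0)) (lookup-replicate e false))) λ ()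
  separating-const t≤k bal i (suc j) i+j≤t
    with c₀ , const₀ ← separating-const t≤k bal i j (≤-trans (+-monoʳ-≤ i (n≤1+n j)) i+j≤t)
       | c₁ , const₁ ← separating-const t≤k bal (suc i) j (≤-trans (≤-reflexive (sym (+-suc i j))) i+j≤t)
    = c₀ ∸ c₁ , solve
    where
    solve : ∀ I J → Avoids I J → ∣ I ∣ ≡ i → ∣ J ∣ ≡ suc j → separating I J ≡ c₀ ∸ c₁
    solve I J I∩J=∅ ∣I∣≡i ∣J∣≡1+j with x , J∋x , ∣J₀∣≡j ← member J ∣J∣≡1+j = begin
      separating I J                            ≡⟨ m+n∸n≡m _ (separating I₁ J₀) ⟨
      separating I J + separating I₁ J₀ ∸ separating I₁ J₀
                                                ≡⟨ cong₂ _∸_ (sym split) (const₁ I₁ J₀ av₁ ∣I₁∣ ∣J₀∣≡j) ⟩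
      separating I J₀ ∸ c₁                      ≡⟨ cong (_∸ c₁) (const₀ I J₀ av₀ ∣I∣≡i ∣J₀∣≡j) ⟩
      c₀ ∸ c₁                                   ∎
      where
      open ≡-Reasoning
      J₀ = J [ x ]≔ false
      I₁ = I [ x ]≔ true
      I∌x : I ∌ x
      I∌x = ¬∋⇒∌ I λ I∋x → ∋∌-absurd J J∋x (I∩J=∅ x I∋x)
      av₀ : Avoids I J₀
      av₀ e I∋e = ¬∋⇒∌ J₀ λ J₀∋e → ∋∌-absurd J (delete-⊑ J x e J₀∋e) (I∩J=∅ e I∋e)
      av₁ : Avoids I₁ J₀
      av₁ e I₁∋e with e Fin.≟ x
      ... | yes refl = lookup∘update x J false
      ... | no e≢x   = av₀ e (trans (sym (lookup∘update′ e≢x I true)) I₁∋e)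
      ∣I₁∣ : ∣ I₁ ∣ ≡ suc i
      ∣I₁∣ = trans (∣insert∣ I x I∌x) (cong suc ∣I∣≡i)
      -- The blocks through `I` that avoid `J₀` are sorted by whether they contain the deleted point
      -- `x`.
      split : separating I J₀ ≡ separating I J + separating I₁ J₀
      split = length-filter-⊎ _ _ _
        (λ {B} (I⊑B , av) → case lookup (proj₁ B) x Bool.≟ true of λ where
          (yes B∋x) → inj₂ (insert-⊑ I (proj₁ B) x I⊑B B∋x , av)
          (no ¬B∋x) → inj₁ (I⊑B , undelete-avoids J (proj₁ B) x av (¬∋⇒∌ (proj₁ B) ¬B∋x)))
        (λ (I⊑B , av) → I⊑B , λ e J₀∋e → av e (delete-⊑ J x e J₀∋e))
        (λ {B} (I₁⊑B , av) → insert-⊒ I (proj₁ B) x I₁⊑B , av)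
        (λ {B} (_ , av) (I₁⊑B , _) → ∋∌-absurd (proj₁ B) (I₁⊑B x (lookup∘update x I true)) (av x J∋x))
        xs

module _ {t v k lam : ℕ} (D : Design t v k lam) where
  open Design D

  private
    blocks-balanced : Balanced blocks t
    blocks-balanced = lam , λ I ∣I∣≡t → trans
      (cong length (filter-≐ (λ B → I ⊑? proj₁ B) (λ B → I ⊆? proj₁ B)
        ((λ {B} → ⊑⇒⊆ I (proj₁ B)) , (λ {B} → ⊆⇒⊑ I (proj₁ B))) blocks))
      (balanced (I , ∣I∣≡t))

  -- A block of size `k` that avoids the complement of `P` is `P` itself, so the multiplicity of `P`
  -- is a value of `separating`. The complement has `v ∸ k` points, at most `t`, as
  -- `separating-const` demands.
  μ-const : v ≤ k + t → ∃[ c ] ∀ P → μ P ≡ c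
  μ-const v≤k+t with c , const ← separating-const blocks t≤k blocks-balanced 0 (v ∸ k) (m≤n+o⇒m∸n≤o v k v≤k+t)
    = c , λ P → trans (cong length (filter-≐ (P ≟ₖ_) _ (equiv P) blocks))
                      (const ∅ (∁ (proj₁ P)) (λ e ∅∋e → contradiction (trans (sym ∅∋e) (lookup-replicate e false)) λ ())
                        (∣⊥∣≡0 v) (trans (∣∁p∣≡n∸∣p∣ (proj₁ P)) (cong (v ∸_) (proj₂ P))))
    where
    equiv : ∀ P → (∀ {B} → P ≡ B → ∅ ⊑ proj₁ B × Avoids (∁ (proj₁ P)) (proj₁ B)) ×
                  (∀ {B} → ∅ ⊑ proj₁ B × Avoids (∁ (proj₁ P)) (proj₁ B) → P ≡ B)
    equiv (p , ∣p∣) = to , λ {B} → from B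
      where
      to : ∀ {B} → (p , ∣p∣) ≡ B → ∅ ⊑ proj₁ B × Avoids (∁ p) (proj₁ B)
      to refl = (λ e ∅∋e → contradiction (trans (sym ∅∋e) (lookup-replicate e false)) λ ()) ,
                λ e ∁p∋e → Bool.not-injective (trans (sym (lookup-map e _ p)) ∁p∋e)
      from : ∀ B → ∅ ⊑ proj₁ B × Avoids (∁ p) (proj₁ B) → (p , ∣p∣) ≡ B
      from (q , ∣q∣) (_ , av) = KSubset-≡ (sym (⊑∧∣∣⇒≡ q p q⊑p (trans ∣q∣ (sym ∣p∣))))
        where
        q⊑p : q ⊑ p
        q⊑p e q∋e = Bool.¬-not λ p∌e → ∋∌-absurd q q∋e (av e (trans (lookup-map e _ p) (cong not p∌e)))

  nontrivial⇒k+t<v : Nontrivial → k + t < v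
  nontrivial⇒k+t<v (_ , _ , nonempty , noncomplete) = ≰⇒> λ v≤k+t → case μ-const v≤k+t of λ where
    (zero  , const) → nonempty const
    (suc c , const) → noncomplete λ P → ≤-trans (s≤s z≤n) (≤-reflexive (sym (const P)))

-- Edges, adjacency, and the trade of one edge for another.

pair : Fin n → Fin n → Subset n
pair i j = (∅ [ j ]≔ true) [ i ]≔ true

lookup-pair : ∀ (i j y : Fin n) → lookup (pair i j) y ≡ does (y Fin.≟ i) ∨ does (y Fin.≟ j)
lookup-pair i j y with y Fin.≟ i
... | yes refl = lookup∘update i (∅ [ j ]≔ true) true
... | no y≢i with y Fin.≟ j
...   | yes refl = trans (lookup∘update′ y≢i (∅ [ y ]≔ true) true) (lookup∘update y ∅ true)
...   | no y≢j   = trans (lookup∘update′ y≢i (∅ [ j ]≔ true) true)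
                   (trans (lookup∘update′ y≢j ∅ true) (lookup-replicate y false))

∣pair∣ : ∀ {i j : Fin n} → i ≢ j → ∣ pair i j ∣ ≡ 2
∣pair∣ {n} {i} {j} i≢j = trans
  (∣insert∣ (∅ [ j ]≔ true) i (trans (lookup∘update′ i≢j ∅ true) (lookup-replicate i false)))
  (cong suc (trans (∣insert∣ ∅ j (lookup-replicate j false)) (cong suc (∣⊥∣≡0 n))))

pair-surjective : ∀ (p : Subset n) → ∣ p ∣ ≡ 2 → ∃[ i ] ∃[ j ] i ≢ j × p ≡ pair i j
pair-surjective p ∣p∣≡2
  with i , p∋i , ∣p₁∣≡1 ← member p ∣p∣≡2
  with j , p₁∋j , ∣p₂∣≡0 ← member (p [ i ]≔ false) ∣p₁∣≡1
  = i , j , i≢j , (begin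
    p                           ≡⟨ restore p i p∋i ⟨
    p₁ [ i ]≔ true              ≡⟨ cong (_[ i ]≔ true) (restore p₁ j p₁∋j) ⟨
    (p₂ [ j ]≔ true) [ i ]≔ true ≡⟨ cong (λ q → (q [ j ]≔ true) [ i ]≔ true) (∣∣≡0⇒∅ p₂ ∣p₂∣≡0) ⟩
    pair i j                    ∎)
  where
  open ≡-Reasoning
  p₁ = p [ i ]≔ false
  p₂ = p₁ [ j ]≔ false
  i≢j : i ≢ j
  i≢j refl = ∋∌-absurd p₁ p₁∋j (lookup∘update i p false)
  restore : ∀ (q : Subset _) x → q ∋ x → (q [ x ]≔ false) [ x ]≔ true ≡ q
  restore q x q∋x = trans ([]≔-idempotent q x) (trans (cong (q [ x ]≔_) (sym q∋x)) ([]≔-lookup q x))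

-- Stated for the inverse because `image` looks points up through `⟨$⟩ˡ`: adjacency in an image is
-- adjacency of the preimages.
pair-image : ∀ (σ : Permutation′ n) i j → image (flip σ) (pair i j) ≡ pair (σ ⟨$⟩ˡ i) (σ ⟨$⟩ˡ j)
pair-image σ i j = subset-ext λ y → begin
  lookup (image (flip σ) (pair i j)) y                       ≡⟨ lookup∘tabulate _ y ⟩
  lookup (pair i j) (σ ⟨$⟩ʳ y)                               ≡⟨ lookup-pair i j (σ ⟨$⟩ʳ y) ⟩
  does (σ ⟨$⟩ʳ y Fin.≟ i) ∨ does (σ ⟨$⟩ʳ y Fin.≟ j)           ≡⟨ cong₂ _∨_ (move y i) (move y j) ⟩
  does (y Fin.≟ σ ⟨$⟩ˡ i) ∨ does (y Fin.≟ σ ⟨$⟩ˡ j)           ≡⟨ lookup-pair (σ ⟨$⟩ˡ i) (σ ⟨$⟩ˡ j) y ⟨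
  lookup (pair (σ ⟨$⟩ˡ i) (σ ⟨$⟩ˡ j)) y                      ∎
  where
  open ≡-Reasoning
  move : ∀ y i → does (σ ⟨$⟩ʳ y Fin.≟ i) ≡ does (y Fin.≟ σ ⟨$⟩ˡ i)
  move y i = does-⇔ (mk⇔ (λ { refl → sym (inverseˡ σ) }) (λ { refl → inverseʳ σ })) (σ ⟨$⟩ʳ y Fin.≟ i) (y Fin.≟ σ ⟨$⟩ˡ i)

abstract
  swap : Fin n → Fin n → Permutation′ n
  swap = transpose

  swap-left : ∀ (y z : Fin n) → swap y z ⟨$⟩ˡ y ≡ z
  swap-left y z with y Fin.≟ z
  ... | yes y≡z = y≡z
  ... | no _ rewrite dec-true (y Fin.≟ y) refl = refl

  swap-right : ∀ (y z : Fin n) → swap y z ⟨$⟩ˡ z ≡ y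
  swap-right y z rewrite dec-true (z Fin.≟ z) refl = refl

  swap-else : ∀ (y z : Fin n) {x} → x ≢ y → x ≢ z → swap y z ⟨$⟩ˡ x ≡ x
  swap-else y z {x} x≢y x≢z
    rewrite dec-false (x Fin.≟ z) x≢z | dec-false (x Fin.≟ y) x≢y = refl

module Graph (n : ℕ) where

  abstract
    label : ∀ {i j : Fin n} → i ≢ j → Fin (n C 2)
    label {i} {j} i≢j = Inverse.to (edges n) (pair i j , ∣pair∣ i≢j)

    label-cong : ∀ {i j a b : Fin n} (i≢j : i ≢ j) (a≢b : a ≢ b) → pair i j ≡ pair a b → label i≢j ≡ label a≢b
    label-cong i≢j a≢b eq = cong (Inverse.to (edges n)) (KSubset-≡ eq)

    label-sym : ∀ {i j : Fin n} (i≢j : i ≢ j) (j≢i : j ≢ i) → label i≢j ≡ label j≢i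
    label-sym {i} {j} i≢j j≢i = label-cong i≢j j≢i ([]≔-commutes ∅ j i j≢i)

    label-pair : ∀ {i j a b : Fin n} (i≢j : i ≢ j) (a≢b : a ≢ b) → label i≢j ≡ label a≢b → pair i j ≡ pair a b
    label-pair i≢j a≢b eq = cong proj₁ (trans (sym (Inverse.strictlyInverseʳ (edges n) _))
      (trans (cong (Inverse.from (edges n)) eq) (Inverse.strictlyInverseʳ (edges n) _)))

    label-∈ˡ : ∀ {i j a b : Fin n} (i≢j : i ≢ j) (a≢b : a ≢ b) → label i≢j ≡ label a≢b → i ≡ a ⊎ i ≡ b
    label-∈ˡ {i} {j} {a} {b} i≢j a≢b eq with i Fin.≟ a | i Fin.≟ b
    ... | yes i≡a | _       = inj₁ i≡a
    ... | no _    | yes i≡b = inj₂ i≡b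
    ... | no i≢a  | no i≢b  = contradiction (begin
      true                                        ≡⟨ cong (_∨ does (i Fin.≟ j)) (dec-true (i Fin.≟ i) refl) ⟨
      does (i Fin.≟ i) ∨ does (i Fin.≟ j)         ≡⟨ lookup-pair i j i ⟨
      lookup (pair i j) i                         ≡⟨ cong (λ p → lookup p i) (label-pair i≢j a≢b eq) ⟩
      lookup (pair a b) i                         ≡⟨ lookup-pair a b i ⟩
      does (i Fin.≟ a) ∨ does (i Fin.≟ b)         ≡⟨ cong₂ _∨_ (dec-false (i Fin.≟ a) i≢a) (dec-false (i Fin.≟ b) i≢b) ⟩
      false                                       ∎) λ ()
      where open ≡-Reasoning

    label-injective : ∀ {i j a b : Fin n} (i≢j : i ≢ j) (a≢b : a ≢ b) → label i≢j ≡ label a≢b →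
                      (i ≡ a × j ≡ b) ⊎ (i ≡ b × j ≡ a)
    label-injective i≢j a≢b eq
      with label-∈ˡ i≢j a≢b eq | label-∈ˡ (i≢j ∘ sym) a≢b (trans (label-sym _ _) eq)
    ... | inj₁ i≡a | inj₂ j≡b = inj₁ (i≡a , j≡b)
    ... | inj₂ i≡b | inj₁ j≡a = inj₂ (i≡b , j≡a)
    ... | inj₁ i≡a | inj₁ j≡a = contradiction (trans i≡a (sym j≡a)) i≢j
    ... | inj₂ i≡b | inj₂ j≡b = contradiction (trans i≡b (sym j≡b)) i≢j

    label-surjective : ∀ (e : Fin (n C 2)) → ∃[ i ] ∃[ j ] Σ[ i≢j ∈ i ≢ j ] e ≡ label i≢j
    label-surjective e with i , j , i≢j , eq ← pair-surjective _ (proj₂ (Inverse.from (edges n) e))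
      = i , j , i≢j , trans (sym (Inverse.strictlyInverseˡ (edges n) e)) (cong (Inverse.to (edges n)) (KSubset-≡ eq))

    onEdges-label : ∀ (σ : Permutation′ n) {i j : Fin n} (i≢j : i ≢ j) (σi≢σj : σ ⟨$⟩ˡ i ≢ σ ⟨$⟩ˡ j) →
                    onEdges σ ⟨$⟩ˡ label i≢j ≡ label σi≢σj
    onEdges-label σ {i} {j} i≢j σi≢σj = cong (Inverse.to (edges n)) (KSubset-≡ (trans
      (cong (image (flip σ)) (cong proj₁ (Inverse.strictlyInverseʳ (edges n) (pair i j , ∣pair∣ i≢j))))
      (pair-image σ i j)))

  abstract
    adj : Subset (n C 2) → Fin n → Fin n → Bool
    adj B i j with i Fin.≟ j
    ... | yes _  = false
    ... | no i≢j = lookup B (label i≢j)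

    adj-label : ∀ (B : Subset (n C 2)) {i j : Fin n} (i≢j : i ≢ j) → adj B i j ≡ lookup B (label i≢j)
    adj-label B {i} {j} i≢j with i Fin.≟ j
    ... | yes i≡j = contradiction i≡j i≢j
    ... | no _    = cong (lookup B) (label-cong _ _ refl)

    adj-irrefl : ∀ (B : Subset (n C 2)) i → adj B i i ≡ false
    adj-irrefl B i with i Fin.≟ i
    ... | yes _  = refl
    ... | no i≢i = contradiction refl i≢i

  adj⇒≢ : ∀ (B : Subset (n C 2)) {i j : Fin n} → adj B i j ≡ true → i ≢ j
  adj⇒≢ B adj-ij refl = contradiction (trans (sym adj-ij) (adj-irrefl B _)) λ ()

  adj-sym : ∀ (B : Subset (n C 2)) i j → adj B i j ≡ adj B j i
  adj-sym B i j = case i Fin.≟ j of λ where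
    (yes refl) → refl
    (no i≢j)   → trans (adj-label B i≢j) (trans (cong (lookup B) (label-sym i≢j (i≢j ∘ sym))) (sym (adj-label B (i≢j ∘ sym))))

  adj-⊑ : ∀ (S B : Subset (n C 2)) → S ⊑ B → ∀ i j → adj S i j ≡ true → adj B i j ≡ true
  adj-⊑ S B S⊑B i j adj-ij = trans (adj-label B i≢j) (S⊑B _ (trans (sym (adj-label S i≢j)) adj-ij))
    where i≢j = adj⇒≢ S adj-ij

  ⊑-adj : ∀ (S B : Subset (n C 2)) → (∀ i j → adj S i j ≡ true → adj B i j ≡ true) → S ⊑ B
  ⊑-adj S B adj⇒ e S∋e with i , j , i≢j , refl ← label-surjective e
    = trans (sym (adj-label B i≢j)) (adj⇒ i j (trans (adj-label S i≢j) S∋e))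

  adj-image : ∀ (σ : Permutation′ n) B i j → adj (image (onEdges σ) B) i j ≡ adj B (σ ⟨$⟩ˡ i) (σ ⟨$⟩ˡ j)
  adj-image σ B i j = case i Fin.≟ j of λ
    { (yes refl) → trans (adj-irrefl (image (onEdges σ) B) i) (sym (adj-irrefl B (σ ⟨$⟩ˡ i)))
    ; (no i≢j)   → let σi≢σj = λ eq → i≢j (trans (sym (inverseʳ σ)) (trans (cong (σ ⟨$⟩ʳ_) eq) (inverseʳ σ))) in begin
      adj (image (onEdges σ) B) i j                 ≡⟨ adj-label (image (onEdges σ) B) i≢j ⟩
      lookup (image (onEdges σ) B) (label i≢j)      ≡⟨ lookup∘tabulate _ (label i≢j) ⟩
      lookup B (onEdges σ ⟨$⟩ˡ label i≢j)           ≡⟨ cong (lookup B) (onEdges-label σ i≢j σi≢σj) ⟩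
      lookup B (label σi≢σj)                        ≡⟨ adj-label B σi≢σj ⟨
      adj B (σ ⟨$⟩ˡ i) (σ ⟨$⟩ˡ j)                   ∎
    }
    where
    open ≡-Reasoning

  module _ (B : Subset (n C 2)) {a b c d : Fin n} (a≢b : a ≢ b) (c≢d : c ≢ d) where

    -- The edge trade of the main argument. By `∣rewire∣` and `rewire-⊑`, a graph with `t` edges
    -- inside a block becomes another such graph whenever the new edge lies in the block.
    rewire : Subset (n C 2)
    rewire = exchange B (label a≢b) (label c≢d)

    adj-rewire : ∀ i j → ¬ ((i ≡ a × j ≡ b) ⊎ (i ≡ b × j ≡ a)) → ¬ ((i ≡ c × j ≡ d) ⊎ (i ≡ d × j ≡ c)) →
                 adj rewire i j ≡ adj B i j
    adj-rewire i j ≢ab ≢cd = case i Fin.≟ j of λ where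
      (yes refl) → trans (adj-irrefl rewire i) (sym (adj-irrefl B i))
      (no i≢j)   → trans (adj-label rewire i≢j) (trans
        (exchange-else B (λ eq → ≢ab (label-injective i≢j a≢b eq)) (λ eq → ≢cd (label-injective i≢j c≢d eq)))
        (sym (adj-label B i≢j)))

    adj-rewire-else : ∀ i → i ≢ a → i ≢ b → i ≢ c → i ≢ d → ∀ j → adj rewire i j ≡ adj B i j
    adj-rewire-else i i≢a i≢b i≢c i≢d j = adj-rewire i j
      [ i≢a ∘ proj₁ , i≢b ∘ proj₁ ]′ [ i≢c ∘ proj₁ , i≢d ∘ proj₁ ]′

    module _ (adj-ab : adj B a b ≡ true) (adj-cd : adj B c d ≡ false) where

      private
        B∋ab : B ∋ label a≢b
        B∋ab = trans (sym (adj-label B a≢b)) adj-ab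
        B∌cd : B ∌ label c≢d
        B∌cd = trans (sym (adj-label B c≢d)) adj-cd

      ∣rewire∣ : ∣ rewire ∣ ≡ ∣ B ∣
      ∣rewire∣ = ∣exchange∣ B B∋ab B∌cd

      adj-rewire-out : adj rewire a b ≡ false
      adj-rewire-out = trans (adj-label rewire a≢b) (exchange-out B B∋ab B∌cd)

      adj-rewire-at : a ≢ c → a ≢ d → ∀ j → j ≢ b → adj rewire a j ≡ adj B a j
      adj-rewire-at a≢c a≢d j j≢b = adj-rewire a j [ j≢b ∘ proj₂ , a≢b ∘ proj₁ ]′ [ a≢c ∘ proj₁ , a≢d ∘ proj₁ ]′

    rewire-⊑ : ∀ (G : Subset (n C 2)) → B ⊑ G → adj G c d ≡ true → rewire ⊑ G
    rewire-⊑ G B⊑G adj-cd = exchange-⊑ B G B⊑G (trans (sym (adj-label G c≢d)) adj-cd)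

-- Twins in the blocks of a graphical design.

filter-nonempty : ∀ {A : Set} {P : A → Set} (P? : Decidable P) xs →
                  0 < length (filter P? xs) → ∃[ x ] x ∈ xs × P x
filter-nonempty P? xs 0<length with filter P? xs in eq
... | x ∷ _ = x , ∈-filter⁻ P? (subst (x ∈_) (sym eq) (here refl))

-- At most one index hits `x`. That index is dropped, or the first one if there is none.
avoid : ∀ {m n} (ι : Fin (suc m) → Fin n) → Injective _≡_ _≡_ ι → ∀ x →
        ∃[ κ ] Injective _≡_ _≡_ κ × (∀ (i : Fin m) → κ i ≢ x × ∃[ j ] κ i ≡ ι j)
avoid ι ι-inj x with Fin.any? (λ i → ι i Fin.≟ x)
... | yes (i , refl) = ι ∘ punchIn i , Fin.punchIn-injective i _ _ ∘ ι-inj , λ j →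
                       (λ eq → Fin.punchInᵢ≢i i j (ι-inj eq)) , punchIn i j , refl
... | no none = ι ∘ suc , Fin.suc-injective ∘ ι-inj , λ j → (λ eq → none (suc j , eq)) , suc j , refl

module _ {n t k lam : ℕ} (D : Design t (n C 2) k lam) where
  open Design D
  open Graph n

  covering-block : 1 ≤ lam → ∀ S → ∣ S ∣ ≡ t → ∃[ B ] B ∈ blocks × S ⊑ proj₁ B
  covering-block 1≤λ S ∣S∣≡t
    with B , B∈blocks , S⊆B ← filter-nonempty (λ B → S ⊆? proj₁ B) blocks
           (≤-trans 1≤λ (≤-reflexive (sym (balanced (S , ∣S∣≡t)))))
    = B , B∈blocks , ⊆⇒⊑ S (proj₁ B) S⊆B

  module _ (graphical : Graphical {n} D) where

    -- A member has positive multiplicity, invariance carries this to the image, and positive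
    -- multiplicity gives membership back.
    image-block : ∀ σ B → B ∈ blocks → imageₖ (onEdges σ) B ∈ blocks
    image-block σ B B∈blocks = case filter-nonempty (imageₖ (onEdges σ) B ≟ₖ_) blocks
      (≤-trans (filter-some (B ≟ₖ_) B∈blocks) (≤-reflexive (sym (graphical σ B)))) of λ where
        (B′ , B′∈blocks , σB≡B′) → subst (_∈ blocks) (sym σB≡B′) B′∈blocks

    module _ (α : Fin n → Bool) where

      -- The function `α` is a prescribed row of the adjacency matrix. Later it marks the outer
      -- vertices, so that a free vertex is joined to exactly these.
      Free : Subset (n C 2) → Fin n → Set
      Free T p = ∀ u → adj T p u ≡ α u

      -- Since `adj` is `false` on the diagonal, `α` vanishes at both `y` and `z` and is therefore
      -- fixed by the transposition. As the two rows are equal, the transposition is an automorphism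
      -- of `T`.
      swap-free : ∀ T {y z} → Free T y → Free T z → ∀ i j →
        adj T (swap y z ⟨$⟩ˡ i) (swap y z ⟨$⟩ˡ j) ≡ adj T i j
      swap-free T {y} {z} free-y free-z i j = both
        where
        τ = swap y z ⟨$⟩ˡ_
        αy≡false : α y ≡ false
        αy≡false = trans (sym (free-y y)) (adj-irrefl T y)
        αz≡false : α z ≡ false
        αz≡false = trans (sym (free-z z)) (adj-irrefl T z)
        ατ : ∀ u → α (τ u) ≡ α u
        ατ u with u Fin.≟ y | u Fin.≟ z
        ... | yes refl | _        = trans (cong α (swap-left y z)) (trans αz≡false (sym αy≡false))
        ... | no _     | yes refl = trans (cong α (swap-right y z)) (trans αy≡false (sym αz≡false))
        ... | no u≢y   | no u≢z   = cong α (swap-else y z u≢y u≢z)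
        left-y : ∀ u → adj T (τ y) (τ u) ≡ adj T y u
        left-y u = trans (cong (λ w → adj T w (τ u)) (swap-left y z)) (trans (free-z (τ u)) (trans (ατ u) (sym (free-y u))))
        left-z : ∀ u → adj T (τ z) (τ u) ≡ adj T z u
        left-z u = trans (cong (λ w → adj T w (τ u)) (swap-right y z)) (trans (free-y (τ u)) (trans (ατ u) (sym (free-z u))))
        flipped : ∀ {a b} → adj T (τ a) (τ b) ≡ adj T a b → adj T (τ b) (τ a) ≡ adj T b a
        flipped eq = trans (adj-sym T _ _) (trans eq (adj-sym T _ _))
        both : adj T (τ i) (τ j) ≡ adj T i j
        both with i Fin.≟ y | i Fin.≟ z | j Fin.≟ y | j Fin.≟ z
        ... | yes refl | _        | _        | _        = left-y j
        ... | no _     | yes refl | _        | _        = left-z j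
        ... | no _     | no _     | yes refl | _        = flipped (left-y i)
        ... | no _     | no _     | no _     | yes refl = flipped (left-z i)
        ... | no i≢y   | no i≢z   | no j≢y   | no j≢z   =
          cong₂ (adj T) (swap-else y z i≢y i≢z) (swap-else y z j≢y j≢z)

      module _ {T} (∣T∣≡t : ∣ T ∣ ≡ t) {B} (B∈blocks : B ∈ blocks) (T⊑B : T ⊑ proj₁ B)
               (ι : Fin (4 + lam) → Fin n) (ι-inj : Injective _≡_ _≡_ ι) (ι-free : ∀ i → Free T (ι i)) where

        swapped⊒T : ∀ {y z} → Free T y → Free T z → T ⊑ image (onEdges (swap y z)) (proj₁ B)
        swapped⊒T {y} {z} free-y free-z = ⊑-adj T _ λ i j adj-ij →
          trans (adj-image (swap y z) (proj₁ B) i j)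
            (adj-⊑ T (proj₁ B) T⊑B _ _ (trans (swap-free T free-y free-z i j) adj-ij))

        -- If x were adjacent to y but not to z, then transposing each vertex w of
        -- the large class with z or y, whichever flips the pair xw, would
        -- give too many distinct blocks through T.
        twins : ∀ {x y z} → Free T y → Free T z → x ≢ y → x ≢ z →
                adj (proj₁ B) x y ≡ true → adj (proj₁ B) x z ≡ true
        twins {x} {y} {z} free-y free-z x≢y x≢z xy = Bool.¬-not λ xz →
          -- Dropping `x`, `y` and `z` from the `4 + lam` free vertices leaves `1 + lam`, one more
          -- than the number of blocks through `T`.
          let κ₁ , κ₁-inj , κ₁-av = avoid ι ι-inj x
              κ₂ , κ₂-inj , κ₂-av = avoid κ₁ κ₁-inj y
              κ₃ , κ₃-inj , κ₃-av = avoid κ₂ κ₂-inj z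
              from₃ = λ i → proj₂ (κ₃-av i)
              from₂ = λ i → proj₂ (κ₂-av (proj₁ (from₃ i)))
              κ₃≢x = λ i eq → proj₁ (κ₁-av (proj₁ (from₂ i))) (trans (sym (proj₂ (from₂ i))) (trans (sym (proj₂ (from₃ i))) eq))
              κ₃≢y = λ i eq → proj₁ (κ₂-av (proj₁ (from₃ i))) (trans (sym (proj₂ (from₃ i))) eq)
              from₁ = λ i → proj₂ (κ₁-av (proj₁ (from₂ i)))
              κ₃-free = λ i → subst (Free T) (sym (trans (proj₂ (from₃ i)) (trans (proj₂ (from₂ i)) (proj₂ (from₁ i))))) (ι-free (proj₁ (from₁ i)))
          in too-many xz κ₃ κ₃-inj κ₃-free κ₃≢x κ₃≢y (λ i → proj₁ (κ₃-av i))
          where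
          module _ (xz : adj (proj₁ B) x z ≡ false) (κ : Fin (suc lam) → Fin n) (κ-inj : Injective _≡_ _≡_ κ)
                   (κ-free : ∀ i → Free T (κ i)) (κ≢x : ∀ i → κ i ≢ x) (κ≢y : ∀ i → κ i ≢ y) (κ≢z : ∀ i → κ i ≢ z) where

            partner : Bool → Fin n
            partner true  = z
            partner false = y

            σ : Fin (suc lam) → Permutation′ n
            σ i = swap (κ i) (partner (adj (proj₁ B) x (κ i)))

            copy : Fin (suc lam) → KSubset (n C 2) k
            copy i = imageₖ (onEdges (σ i)) B

            partner≢ : ∀ b {w} → w ≢ y → w ≢ z → w ≢ partner b
            partner≢ true  _   w≢z = w≢z
            partner≢ false w≢y _   = w≢y

            partner-free : ∀ b → Free T (partner b)
            partner-free true  = free-z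
            partner-free false = free-y

            partner-flips : ∀ b → adj (proj₁ B) x (partner b) ≡ not b
            partner-flips true  = xz
            partner-flips false = xy

            fixes-x : ∀ i → σ i ⟨$⟩ˡ x ≡ x
            fixes-x i = swap-else (κ i) _ (κ≢x i ∘ sym) (partner≢ (adj (proj₁ B) x (κ i)) x≢y x≢z)

            flips : ∀ i → adj (proj₁ (copy i)) x (κ i) ≡ not (adj (proj₁ B) x (κ i))
            flips i = trans (adj-image (σ i) (proj₁ B) x (κ i)) (trans
              (cong₂ (adj (proj₁ B)) (fixes-x i) (swap-left (κ i) _))
              (partner-flips (adj (proj₁ B) x (κ i))))

            keeps : ∀ i j → κ i ≢ κ j → adj (proj₁ (copy i)) x (κ j) ≡ adj (proj₁ B) x (κ j)
            keeps i j κi≢κj = trans (adj-image (σ i) (proj₁ B) x (κ j)) (cong₂ (adj (proj₁ B)) (fixes-x i)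
              (swap-else (κ i) _ (κi≢κj ∘ sym) (partner≢ (adj (proj₁ B) x (κ i)) (κ≢y j) (κ≢z j))))

            -- At the pair of `x` and `κ j`, the copy with index `j` reverses `B`, whereas a copy
            -- with another index agrees with `B`.
            copy-inj : Injective _≡_ _≡_ copy
            copy-inj {i} {j} eq = case κ i Fin.≟ κ j of λ where
              (yes κi≡κj) → κ-inj κi≡κj
              (no κi≢κj)  → contradiction
                (trans (sym (keeps i j κi≢κj)) (trans (cong (λ C → adj (proj₁ C) x (κ j)) eq) (flips j)))
                (Bool.not-¬ refl)

            too-many : ∀ {A : Set} → A
            too-many = contradiction
              (≤-trans (injection-into-list (filter (λ B → T ⊆? proj₁ B) blocks) copy-inj λ i →
                  ∈-filter⁺ (λ B → T ⊆? proj₁ B) (image-block (σ i) B B∈blocks)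
                    (⊑⇒⊆ T _ (swapped⊒T (κ-free i) (partner-free (adj (proj₁ B) x (κ i))))))
                (≤-reflexive (balanced (T , ∣T∣≡t))))
              (<-irrefl refl)

-- Graphs defined by vertex numbers, and the number of outer edges.

does⁻ : ∀ {A : Set} (a? : Dec A) → does a? ≡ true → A
does⁻ (yes a) _ = a

<⇒≢ᶠ : ∀ {n} {i j : Fin n} → toℕ i < toℕ j → i ≢ j
<⇒≢ᶠ i<j refl = <-irrefl refl i<j

module _ (n : ℕ) where
  open Graph n

  module _ {R : ℕ → ℕ → Set} (R? : ∀ p r → Dec (R p r)) where

    private
      -- Symmetrised because `label-surjective` returns the endpoints of an edge in no prescribed
      -- order.
      joined? : ∀ (i j : Fin n) → Dec (R (toℕ i) (toℕ j) ⊎ R (toℕ j) (toℕ i))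
      joined? i j = R? (toℕ i) (toℕ j) ⊎-dec R? (toℕ j) (toℕ i)

    abstract
      graph : Subset (n C 2)
      graph = tabulate λ e → let i , j , _ = label-surjective e in does (joined? i j)

      graph⁺ : ∀ {i j} → i ≢ j → R (toℕ i) (toℕ j) ⊎ R (toℕ j) (toℕ i) → adj graph i j ≡ true
      graph⁺ {i} {j} i≢j Rij = trans (adj-label graph i≢j) (trans (lookup∘tabulate _ (label i≢j)) lemma)
        where
        lemma : (let a , b , _ = label-surjective (label i≢j)) → does (joined? a b) ≡ true
        lemma = let a , b , a≢b , eq = label-surjective (label i≢j) in
          case label-injective i≢j a≢b eq of λ where
            (inj₁ (i≡a , j≡b)) → dec-true (joined? a b) (subst₂ (λ a b → R (toℕ a) (toℕ b) ⊎ R (toℕ b) (toℕ a)) i≡a j≡b Rij)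
            (inj₂ (i≡b , j≡a)) → dec-true (joined? a b) (⊎-swap (subst₂ (λ b a → R (toℕ b) (toℕ a) ⊎ R (toℕ a) (toℕ b)) i≡b j≡a Rij))

      graph⁻ : ∀ i j → adj graph i j ≡ true → R (toℕ i) (toℕ j) ⊎ R (toℕ j) (toℕ i)
      graph⁻ i j adj-ij = let a , b , a≢b , eq = label-surjective (label i≢j) in
        case label-injective i≢j a≢b eq of λ where
          (inj₁ (i≡a , j≡b)) → subst₂ (λ a b → R (toℕ a) (toℕ b) ⊎ R (toℕ b) (toℕ a)) (sym i≡a) (sym j≡b) related
          (inj₂ (i≡b , j≡a)) → ⊎-swap (subst₂ (λ a b → R (toℕ a) (toℕ b) ⊎ R (toℕ b) (toℕ a)) (sym j≡a) (sym i≡b) related)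
        where
        i≢j : i ≢ j
        i≢j = adj⇒≢ graph adj-ij
        related : (let a , b , _ = label-surjective (label i≢j)) → R (toℕ a) (toℕ b) ⊎ R (toℕ b) (toℕ a)
        related = let a , b , _ = label-surjective (label i≢j) in
          does⁻ (joined? a b) (trans (sym (lookup∘tabulate _ (label i≢j))) (trans (sym (adj-label graph i≢j)) adj-ij))

    graph-∋⁺ : ∀ {i j} (i≢j : i ≢ j) → R (toℕ i) (toℕ j) → graph ∋ label i≢j
    graph-∋⁺ i≢j Rij = trans (sym (adj-label graph i≢j)) (graph⁺ i≢j (inj₁ Rij))

    graph-∋⁻ : ∀ {i j} (i≢j : i ≢ j) → graph ∋ label i≢j → R (toℕ i) (toℕ j) ⊎ R (toℕ j) (toℕ i)
    graph-∋⁻ i≢j ∋ij = graph⁻ _ _ (trans (adj-label graph i≢j) ∋ij)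

  graph-⊑ : ∀ {R Q : ℕ → ℕ → Set} (R? : ∀ p r → Dec (R p r)) (Q? : ∀ p r → Dec (Q p r)) →
            (∀ {p r} → R p r → Q p r) → graph R? ⊑ graph Q?
  graph-⊑ R? Q? R⇒Q = ⊑-adj (graph R?) (graph Q?) λ i j adj-ij →
    graph⁺ Q? (adj⇒≢ (graph R?) adj-ij) ([ inj₁ ∘ R⇒Q , inj₂ ∘ R⇒Q ]′ (graph⁻ R? i j adj-ij))

  -- Through the symmetrisation in `graph`, one endpoint numbered `N` or more suffices.
  outer : ℕ → Subset (n C 2)
  outer N = graph (λ p _ → N ≤? p)

  ∣outer-n∣ : ∣ outer n ∣ ≡ 0
  ∣outer-n∣ = n≤0⇒n≡0 (≤-trans (⊑⇒∣∣≤ (outer n) ∅ ⊑∅) (≤-reflexive (∣⊥∣≡0 (n C 2))))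
    where
    ⊑∅ : outer n ⊑ ∅
    ⊑∅ e ∋e with i , j , i≢j , refl ← label-surjective e = contradiction (graph-∋⁻ _ i≢j ∋e)
      [ <⇒≱ (Fin.toℕ<n i) , <⇒≱ (Fin.toℕ<n j) ]′

  ∣outer-0∣ : n C 2 ≤ ∣ outer 0 ∣
  ∣outer-0∣ = ≤-trans (≤-reflexive (sym (∣⊤∣≡n (n C 2)))) (⊑⇒∣∣≤ full (outer 0) λ e _ → full⊑ e)
    where
    full⊑ : ∀ e → outer 0 ∋ e
    full⊑ e with i , j , i≢j , refl ← label-surjective e = graph-∋⁺ _ i≢j z≤n

  -- The only new edges are those of the star that joins vertex `N` to the `N` vertices before it.
  ∣outer∣-step : ∀ N → N < n → ∣ outer N ∣ ≤ N + ∣ outer (suc N) ∣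
  ∣outer∣-step N N<n = ∣∣-upper (outer (suc N)) (outer N) star cover
    where
    c : Fin n
    c = fromℕ< N<n
    c≡N : toℕ c ≡ N
    c≡N = Fin.toℕ-fromℕ< N<n
    leaf : Fin N → Fin n
    leaf u = fromℕ< (<-trans (Fin.toℕ<n u) N<n)
    leaf≡ : ∀ u → toℕ (leaf u) ≡ toℕ u
    leaf≡ u = Fin.toℕ-fromℕ< _
    c≢leaf : ∀ u → c ≢ leaf u
    c≢leaf u = <⇒≢ᶠ (subst₂ _<_ (sym (leaf≡ u)) (sym c≡N) (Fin.toℕ<n u)) ∘ sym
    star : Fin N → Fin (n C 2)
    star u = label (c≢leaf u)
    at-c : ∀ {i j} (i≢j : i ≢ j) → N ≤ toℕ i →
           outer (suc N) ∋ label i≢j ⊎ ∃[ u ] star u ≡ label i≢j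
    at-c {i} {j} i≢j N≤i with suc N ≤? toℕ i | suc N ≤? toℕ j
    ... | yes N<i | _       = inj₁ (graph-∋⁺ _ i≢j N<i)
    ... | no _    | yes N<j = inj₁ (trans (cong (lookup (outer (suc N))) (label-sym i≢j (i≢j ∘ sym))) (graph-∋⁺ _ (i≢j ∘ sym) N<j))
    ... | no N≮i  | no N≮j  = inj₂ (fromℕ< j<N , label-cong _ _ (cong₂ pair c≡i leaf≡j))
      where
      i≡N : toℕ i ≡ N
      i≡N = ≤-antisym (≮⇒≥ N≮i) N≤i
      c≡i : c ≡ i
      c≡i = Fin.toℕ-injective (trans c≡N (sym i≡N))
      j<N : toℕ j < N
      j<N = ≤∧≢⇒< (≮⇒≥ N≮j) λ j≡N → i≢j (Fin.toℕ-injective (trans i≡N (sym j≡N)))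
      leaf≡j : leaf (fromℕ< j<N) ≡ j
      leaf≡j = Fin.toℕ-injective (trans (leaf≡ _) (Fin.toℕ-fromℕ< j<N))
    cover : ∀ e → outer N ∋ e → outer (suc N) ∋ e ⊎ ∃[ u ] star u ≡ e
    cover e ∋e with i , j , i≢j , refl ← label-surjective e = case graph-∋⁻ _ i≢j ∋e of λ where
      (inj₁ N≤i) → at-c i≢j N≤i
      (inj₂ N≤j) → let j≢i = i≢j ∘ sym ; flip = label-sym j≢i i≢j in case at-c j≢i N≤j of λ where
        (inj₁ ∋ji)      → inj₁ (trans (cong (lookup (outer (suc N))) (sym flip)) ∋ji)
        (inj₂ (u , eq)) → inj₂ (u , trans eq flip)

  -- Reversing the vertices maps the complement of outer N into outer N.
  ∣outer∣-half : ∀ N → N + N ≤ n → n C 2 ≤ ∣ outer N ∣ + ∣ outer N ∣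
  ∣outer∣-half N N+N≤n = begin
    n C 2                                   ≡⟨ m+[n∸m]≡n (∣p∣≤n A) ⟨
    ∣ A ∣ + (n C 2 ∸ ∣ A ∣)                 ≡⟨ cong (∣ A ∣ +_) (∣∁p∣≡n∸∣p∣ A) ⟨
    ∣ A ∣ + ∣ ∁ A ∣                         ≡⟨ cong (∣ A ∣ +_) (∣image∣ (onEdges {n} reverse) (∁ A)) ⟨
    ∣ A ∣ + ∣ A′ ∣                          ≤⟨ +-monoʳ-≤ ∣ A ∣ (⊑⇒∣∣≤ A′ A reversed⊑A) ⟩
    ∣ A ∣ + ∣ A ∣                           ∎
    where
    open ≤-Reasoning
    A = outer N
    A′ = image (onEdges {n} reverse) (∁ A)
    reversed⊑A : A′ ⊑ A
    reversed⊑A = ⊑-adj A′ A λ i j adj-ij → graph⁺ _ (adj⇒≢ A′ adj-ij) (inj₁ (N≤ i j (trans (sym (adj-image reverse (∁ A) i j)) adj-ij)))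
      where
      N≤ : ∀ i j → adj (∁ A) (opposite i) (opposite j) ≡ true → N ≤ toℕ i
      N≤ i j adj-ij = ≮⇒≥ λ i<N → ∋∌-absurd A
        (graph-∋⁺ _ i′≢j′ (begin
          N                   ≡⟨ m+n∸m≡n N N ⟨
          N + N ∸ N           ≤⟨ ∸-mono N+N≤n i<N ⟩
          n ∸ suc (toℕ i)     ≡⟨ Fin.opposite-prop i ⟨
          toℕ (opposite i)    ∎))
        (Bool.not-injective (trans (sym (lookup-map (label i′≢j′) not A)) (trans (sym (adj-label (∁ A) i′≢j′)) adj-ij)))
        where
        i′≢j′ : opposite i ≢ opposite j
        i′≢j′ = adj⇒≢ (∁ A) adj-ij

-- The test graph and its number of edges.

-- The test graph consists of all outer edges, two isolated edges and part of a
-- K_{4,q}.  The isolated edges supply three leaves and cannot be met by a single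
-- vertex; the spokes make up the number of edges while touching few vertices.
data SmallEdge : ℕ → ℕ → Set where
  01-edge : SmallEdge 0 1
  23-edge : SmallEdge 2 3

smallEdge? : ∀ p r → Dec (SmallEdge p r)
smallEdge? 0 1 = yes 01-edge
smallEdge? 2 3 = yes 23-edge
smallEdge? 0 0 = no λ ()
smallEdge? 0 (suc (suc _)) = no λ ()
smallEdge? 1 _ = no λ ()
smallEdge? 2 0 = no λ ()
smallEdge? 2 1 = no λ ()
smallEdge? 2 2 = no λ ()
smallEdge? 2 (suc (suc (suc (suc _)))) = no λ ()
smallEdge? (suc (suc (suc _))) _ = no λ ()

-- The hubs 4 to 7 and the tips from 8 on are disjoint from each other and from the isolated edges
-- on 0 to 3, so a spoke never spoils a leaf.
Spoke : ℕ → ℕ → ℕ → Set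
Spoke q p r = (4 ≤ p × p < 8) × (8 ≤ r × r < 8 + q)

spoke? : ∀ q p r → Dec (Spoke q p r)
spoke? q p r = ((4 ≤? p) ×-dec (p <? 8)) ×-dec ((8 ≤? r) ×-dec (r <? 8 + q))

Lower : ℕ → ℕ → ℕ → Set
Lower N p r = N ≤ p ⊎ SmallEdge p r

lower? : ∀ N p r → Dec (Lower N p r)
lower? N p r = (N ≤? p) ⊎-dec smallEdge? p r

Upper : ℕ → ℕ → ℕ → ℕ → Set
Upper N q p r = Lower N p r ⊎ Spoke q p r

upper? : ∀ N q p r → Dec (Upper N q p r)
upper? N q p r = lower? N p r ⊎-dec spoke? q p r

module _ (n : ℕ) where
  open Graph n

  lower : ℕ → Subset (n C 2)
  lower N = graph n (lower? N)

  upper : ℕ → ℕ → Subset (n C 2)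
  upper N q = graph n (upper? N q)

  module _ {N : ℕ} (N≤n : N ≤ n) where

    private
      vertex : ∀ {m} → m < N → Fin n
      vertex m<N = fromℕ< (<-≤-trans m<N N≤n)

      vertex≡ : ∀ {m} (m<N : m < N) → toℕ (vertex m<N) ≡ m
      vertex≡ _ = Fin.toℕ-fromℕ< _

    -- Only the two isolated edges are added to the outer ones. Together with `∣upper∣` this
    -- brackets `t` for `between`.
    ∣lower∣ : 4 ≤ N → ∣ lower N ∣ ≤ 2 + ∣ outer n N ∣
    ∣lower∣ 4≤N = ∣∣-upper (outer n N) (lower N) small-label cover
      where
      v<N : ∀ {m} → m < 4 → m < N
      v<N m<4 = <-≤-trans m<4 4≤N
      distinct : ∀ {l m} (l<4 : l < 4) (m<4 : m < 4) → l < m → vertex (v<N l<4) ≢ vertex (v<N m<4)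
      distinct l<4 m<4 l<m = <⇒≢ᶠ (subst₂ _<_ (sym (vertex≡ (v<N l<4))) (sym (vertex≡ (v<N m<4))) l<m)
      1≤4 : 1 ≤ 4
      1≤4 = m≤m+n 1 3
      2≤4 : 2 ≤ 4
      2≤4 = m≤m+n 2 2
      3≤4 : 3 ≤ 4
      3≤4 = m≤m+n 3 1
      0≢1 = distinct 1≤4 2≤4 ≤-refl
      2≢3 = distinct 3≤4 ≤-refl ≤-refl
      small : ∀ {i j} (i≢j : i ≢ j) {l m} (l<4 : l < 4) (m<4 : m < 4) l≢m → toℕ i ≡ l → toℕ j ≡ m →
              label {vertex (v<N l<4)} {vertex (v<N m<4)} l≢m ≡ label i≢j
      small i≢j l<4 m<4 l≢m i≡l j≡m = label-cong l≢m i≢j (cong₂ pair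
        (Fin.toℕ-injective (trans (vertex≡ (v<N l<4)) (sym i≡l))) (Fin.toℕ-injective (trans (vertex≡ (v<N m<4)) (sym j≡m))))
      small-label : Fin 2 → Fin (n C 2)
      small-label zero    = label 0≢1
      small-label (suc _) = label 2≢3
      small-edge : ∀ {i j} (i≢j : i ≢ j) {l m} → toℕ i ≡ l → toℕ j ≡ m → SmallEdge l m →
                   ∃[ u ] small-label u ≡ label i≢j
      small-edge i≢j i≡ j≡ 01-edge = zero , small i≢j 1≤4 2≤4 0≢1 i≡ j≡
      small-edge i≢j i≡ j≡ 23-edge = suc zero , small i≢j 3≤4 ≤-refl 2≢3 i≡ j≡
      directed : ∀ {i j} (i≢j : i ≢ j) → Lower N (toℕ i) (toℕ j) →
                 outer n N ∋ label i≢j ⊎ ∃[ u ] small-label u ≡ label i≢j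
      directed i≢j (inj₁ N≤i) = inj₁ (graph-∋⁺ n (λ p _ → N ≤? p) i≢j N≤i)
      directed i≢j (inj₂ ij)  = inj₂ (small-edge i≢j refl refl ij)
      cover : ∀ e → lower N ∋ e → outer n N ∋ e ⊎ ∃[ u ] small-label u ≡ e
      cover e ∋e with i , j , i≢j , refl ← label-surjective e = case graph-∋⁻ n (lower? N) i≢j ∋e of λ where
        (inj₁ ij) → directed i≢j ij
        (inj₂ ji) → subst (λ e → outer n N ∋ e ⊎ ∃[ u ] small-label u ≡ e) (label-sym (i≢j ∘ sym) i≢j) (directed (i≢j ∘ sym) ji)

    -- Only spokes are counted on top of the outer edges, indexed by hub and tip through `remQuot`.
    -- The bound on `q` keeps all of them among the inner vertices.
    ∣upper∣ : ∀ q → 8 + q ≤ N → 4 * q + ∣ outer n N ∣ ≤ ∣ upper N q ∣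
    ∣upper∣ q 8+q≤N = ∣∣-lower (outer n N) (upper N q) (spoke ∘ remQuot q) (remQuot-injective ∘ spoke-injective)
      (graph-⊑ n _ _ (inj₁ ∘ inj₁))
      (λ i → ¬∋⇒∌ (outer n N) (not-outer (remQuot q i)))
      (λ i → graph-∋⁺ n (upper? N q) _ (inj₂ (is-spoke (remQuot q i))))
      where
      hub<8 : ∀ (h : Fin 4) → 4 + toℕ h < 8
      hub<8 h = +-monoʳ-< 4 (Fin.toℕ<n h)
      tip<8+q : ∀ (r : Fin q) → 8 + toℕ r < 8 + q
      tip<8+q r = +-monoʳ-< 8 (Fin.toℕ<n r)
      8≤N : 8 ≤ N
      8≤N = ≤-trans (m≤m+n 8 q) 8+q≤N
      hub : Fin 4 → Fin n
      hub h = vertex (<-≤-trans (hub<8 h) 8≤N)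
      tip : Fin q → Fin n
      tip r = vertex (<-≤-trans (tip<8+q r) 8+q≤N)
      hub≡ : ∀ h → toℕ (hub h) ≡ 4 + toℕ h
      hub≡ h = vertex≡ (<-≤-trans (hub<8 h) 8≤N)
      tip≡ : ∀ r → toℕ (tip r) ≡ 8 + toℕ r
      tip≡ r = vertex≡ (<-≤-trans (tip<8+q r) 8+q≤N)
      hub≢tip : ∀ h r → hub h ≢ tip r
      hub≢tip h r = <⇒≢ᶠ (subst₂ _<_ (sym (hub≡ h)) (sym (tip≡ r)) (<-≤-trans (hub<8 h) (m≤m+n 8 _)))
      spoke : Fin 4 × Fin q → Fin (n C 2)
      spoke (h , r) = label (hub≢tip h r)
      spoke-injective : Injective _≡_ _≡_ spoke
      spoke-injective {h , r} {h′ , r′} eq = case label-injective (hub≢tip h r) (hub≢tip h′ r′) eq of λ where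
        (inj₁ (h≡ , r≡)) → cong₂ _,_
          (Fin.toℕ-injective (+-cancelˡ-≡ 4 _ _ (trans (sym (hub≡ h)) (trans (cong toℕ h≡) (hub≡ h′)))))
          (Fin.toℕ-injective (+-cancelˡ-≡ 8 _ _ (trans (sym (tip≡ r)) (trans (cong toℕ r≡) (tip≡ r′)))))
        (inj₂ (h≡r′ , _)) → contradiction h≡r′ (hub≢tip h r′)
      remQuot-injective : ∀ {i j : Fin (4 * q)} → remQuot {4} q i ≡ remQuot q j → i ≡ j
      remQuot-injective {i} {j} eq = trans (sym (Fin.combine-remQuot {4} q i)) (trans (cong (uncurry combine) eq) (Fin.combine-remQuot {4} q j))
      is-spoke : ∀ ((h , r) : Fin 4 × Fin q) → Spoke q (toℕ (hub h)) (toℕ (tip r))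
      is-spoke (h , r) rewrite hub≡ h | tip≡ r = (m≤m+n 4 _ , hub<8 h) , (m≤m+n 8 _ , tip<8+q r)
      not-outer : ∀ x → ¬ outer n N ∋ spoke x
      not-outer (h , r) ∋x = case graph-∋⁻ n _ (hub≢tip h r) ∋x of λ where
        (inj₁ N≤h) → <⇒≱ (Fin.toℕ<n h) (contradiction (≤-trans 8≤N (≤-trans N≤h (≤-reflexive (hub≡ h)))) (<⇒≱ (hub<8 h)))
        (inj₂ N≤r) → <⇒≱ (tip<8+q r) (≤-trans 8+q≤N (≤-trans N≤r (≤-reflexive (tip≡ r))))

-- A block through the test graph would be the complete graph.

off-pair : ∀ {n} {a b c : Fin n} (f₁ f₂ : Fin n) → a ≢ b → a ≢ c → b ≢ c →
           (a ≢ f₁ × a ≢ f₂) ⊎ (b ≢ f₁ × b ≢ f₂) ⊎ (c ≢ f₁ × c ≢ f₂)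
off-pair {a = a} {b} f₁ f₂ a≢b a≢c b≢c with a Fin.≟ f₁ | a Fin.≟ f₂ | b Fin.≟ f₁ | b Fin.≟ f₂
... | no a≢₁   | no a≢₂   | _        | _        = inj₁ (a≢₁ , a≢₂)
... | _        | _        | no b≢₁   | no b≢₂   = inj₂ (inj₁ (b≢₁ , b≢₂))
... | yes refl | _        | _        | yes refl = inj₂ (inj₂ (a≢c ∘ sym , b≢c ∘ sym))
... | _        | yes refl | yes refl | _        = inj₂ (inj₂ (b≢c ∘ sym , a≢c ∘ sym))
... | yes refl | _        | yes refl | _        = contradiction refl a≢b
... | _        | yes refl | _        | yes refl = contradiction refl a≢b

module _ {n t k lam : ℕ} (D : Design t (n C 2) k lam) (graphical : Graphical {n} D)
         (t<k : t < k) (k<v : k < n C 2)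
         -- The inequality `room` provides three ranges of inner vertices: the first `9 + q` contain
         -- the inner edges of `S` and the hub, the next `9 + q` are spent one by one in trades, and
         -- `4 + lam` more stay free for `twins`.
         (N q : ℕ) (N≤n : N ≤ n) (room : (9 + q) + (9 + q) + (4 + lam) ≤ N)
         {S : Subset (n C 2)} (∣S∣≡t : ∣ S ∣ ≡ t) (lower⊑S : lower n N ⊑ S) (S⊑upper : S ⊑ upper n N q)
         {B : KSubset (n C 2) k} (B∈blocks : B ∈ Design.blocks D) (S⊑B : S ⊑ proj₁ B) where

  open Design D
  open Graph n

  private
    b : Subset (n C 2)
    b = proj₁ B

    -- Inner vertices from w on are isolated in S; the hub x found below is one of
    -- 0, …, w, so the vertices from w′ on are all different from it.
    w w′ : ℕ
    w  = 8 + q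
    w′ = 9 + q

    w′+w′≤N : w′ + w′ ≤ N
    w′+w′≤N = ≤-trans (m≤m+n (w′ + w′) (4 + lam)) room

    w′<N : w′ < N
    w′<N = ≤-trans (+-monoʳ-≤ 1 (m≤m+n w′ (w + 0))) (≤-trans (≤-reflexive lemma) w′+w′≤N)
      where
      lemma : 1 + (w′ + (w + 0)) ≡ w′ + w′
      lemma = trans (cong (λ z → suc (w′ + z)) (+-identityʳ w)) (sym (+-suc w′ w))

    w<N : w < N
    w<N = <-trans (n<1+n w) w′<N

    abstract
      vertex : ∀ {m} → .(m < N) → Fin n
      vertex m<N = fromℕ< (<-≤-trans m<N N≤n)

      toℕ-vertex : ∀ {m} .(m<N : m < N) → toℕ (vertex m<N) ≡ m
      toℕ-vertex m<N = Fin.toℕ-fromℕ< (<-≤-trans m<N N≤n)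

    α : Fin n → Bool
    α u = does (N ≤? toℕ u)

    α-inner : ∀ {u} → toℕ u < N → α u ≡ false
    α-inner u<N = dec-false (N ≤? _) (<⇒≱ u<N)

    α-outer : ∀ {u} → N ≤ toℕ u → α u ≡ true
    α-outer N≤u = dec-true (N ≤? _) N≤u

    flip-adj : ∀ (G : Subset (n C 2)) {i j x} → adj G i j ≡ x → adj G j i ≡ x
    flip-adj G eq = trans (adj-sym G _ _) eq

    S-outer : ∀ {a u} → N ≤ toℕ a → a ≢ u → adj S a u ≡ true
    S-outer N≤a a≢u = adj-⊑ (lower n N) S lower⊑S _ _ (graph⁺ n (lower? N) a≢u (inj₁ (inj₁ N≤a)))

    S-edge : ∀ i j → adj S i j ≡ true → Upper N q (toℕ i) (toℕ j) ⊎ Upper N q (toℕ j) (toℕ i)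
    S-edge i j = graph⁻ n (upper? N q) i j ∘ adj-⊑ S (upper n N q) S⊑upper i j

    S-small : ∀ {i j} → SmallEdge (toℕ i) (toℕ j) → i ≢ j → adj S i j ≡ true
    S-small ij i≢j = adj-⊑ (lower n N) S lower⊑S _ _ (graph⁺ n (lower? N) i≢j (inj₁ (inj₂ ij)))

    -- Outer vertices are joined to everything in `S`, so only inner vertices `u` need checking. The
    -- predicate `P` allows the stem of a leaf to be exempted.
    S-row : ∀ i (P : Fin n → Set) → toℕ i < N → (∀ u → toℕ u < N → P u →
            ¬ (Upper N q (toℕ i) (toℕ u) ⊎ Upper N q (toℕ u) (toℕ i))) → ∀ u → P u → adj S i u ≡ α u
    S-row i P i<N none u Pu = case N ≤? toℕ u of λ where
      (yes N≤u) → trans (flip-adj S (S-outer N≤u (<⇒≢ᶠ (<-≤-trans i<N N≤u) ∘ sym))) (sym (α-outer N≤u))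
      (no N≰u)  → trans (Bool.¬-not (none u (≰⇒> N≰u) Pu ∘ S-edge i u)) (sym (α-inner (≰⇒> N≰u)))

    F : Subset (n C 2) → Fin n → Set
    F = Free D graphical α

    -- All inner edges of `upper n N q` have both endpoints below `w`.
    far-free : ∀ p → w ≤ toℕ p → toℕ p < N → F S p
    far-free p w≤p p<N u = S-row p (λ _ → ⊤) p<N none u tt
      where
      8≤p : 8 ≤ toℕ p
      8≤p = ≤-trans (m≤m+n 8 q) w≤p
      small< : ∀ {l m} → SmallEdge l m → l < 8 × m < 8
      small< 01-edge = m≤m+n 1 7 , m≤m+n 2 6
      small< 23-edge = m≤m+n 3 5 , m≤m+n 4 4
      none : ∀ u → toℕ u < N → ⊤ → ¬ (Upper N q (toℕ p) (toℕ u) ⊎ Upper N q (toℕ u) (toℕ p))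
      none u u<N _ (inj₁ (inj₁ (inj₁ N≤p))) = <⇒≱ p<N N≤p
      none u u<N _ (inj₁ (inj₁ (inj₂ e)))   = <⇒≱ (proj₁ (small< e)) 8≤p
      none u u<N _ (inj₁ (inj₂ ((_ , p<8) , _))) = <⇒≱ p<8 8≤p
      none u u<N _ (inj₂ (inj₁ (inj₁ N≤u))) = <⇒≱ u<N N≤u
      none u u<N _ (inj₂ (inj₁ (inj₂ e)))   = <⇒≱ (proj₂ (small< e)) 8≤p
      none u u<N _ (inj₂ (inj₂ (_ , (_ , p<w)))) = <⇒≱ p<w w≤p

    ι : Fin (4 + lam) → Fin n
    ι i = vertex {w′ + w′ + toℕ i} (<-≤-trans (+-monoʳ-< (w′ + w′) (Fin.toℕ<n i)) room)

    toℕ-ι : ∀ i → toℕ (ι i) ≡ w′ + w′ + toℕ i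
    toℕ-ι i = toℕ-vertex _

    ι-injective : Injective _≡_ _≡_ ι
    ι-injective {i} {j} eq = Fin.toℕ-injective (+-cancelˡ-≡ (w′ + w′) _ _
      (trans (sym (toℕ-ι i)) (trans (cong toℕ eq) (toℕ-ι j))))

    ι<N : ∀ i → toℕ (ι i) < N
    ι<N i = subst (_< N) (sym (toℕ-ι i)) (<-≤-trans (+-monoʳ-< (w′ + w′) (Fin.toℕ<n i)) room)

    ≤ι : ∀ i → w′ + w′ ≤ toℕ (ι i)
    ≤ι i = subst (w′ + w′ ≤_) (sym (toℕ-ι i)) (m≤m+n (w′ + w′) _)

    FarFree : Subset (n C 2) → Set
    FarFree G = ∀ p → w′ + w′ ≤ toℕ p → toℕ p < N → F G p

    -- Stated for a general `G` because `S` will be replaced by graphs obtained from it by trades.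
    twins-in : ∀ G → ∣ G ∣ ≡ t → G ⊑ b → FarFree G → ∀ {x y z} → F G y → F G z → x ≢ y → x ≢ z →
               adj b x y ≡ true → adj b x z ≡ true
    twins-in G ∣G∣≡t G⊑b far = twins D graphical α ∣G∣≡t {B} B∈blocks G⊑b ι ι-injective (λ i → far (ι i) (≤ι i) (ι<N i))

    S-far : FarFree S
    S-far p w′+w′≤p = far-free p (≤-trans (n≤1+n w) (≤-trans (m≤m+n w′ w′) w′+w′≤p))

    far-twins : ∀ {x y z} → w ≤ toℕ y → toℕ y < N → w ≤ toℕ z → toℕ z < N → x ≢ y → x ≢ z →
                adj b x y ≡ true → adj b x z ≡ true
    far-twins w≤y y<N w≤z z<N = twins-in S ∣S∣≡t S⊑B S-far (far-free _ w≤y y<N) (far-free _ w≤z z<N)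

    b-outer : ∀ {a u} → N ≤ toℕ a → a ≢ u → adj b a u ≡ true
    b-outer N≤a a≢u = adj-⊑ S b S⊑B _ _ (S-outer N≤a a≢u)

    v₀ v₁ v₂ v₃ : Fin n
    v₀ = vertex {0} (<-trans (s≤s z≤n) w′<N)
    v₁ = vertex {1} (<-trans (s≤s (s≤s z≤n)) w′<N)
    v₂ = vertex {2} (<-trans (s≤s (s≤s (s≤s z≤n))) w′<N)
    v₃ = vertex {3} (<-trans (s≤s (s≤s (s≤s (s≤s z≤n)))) w′<N)

    ≡0 : toℕ v₀ ≡ 0
    ≡0 = toℕ-vertex _
    ≡1 : toℕ v₁ ≡ 1
    ≡1 = toℕ-vertex _
    ≡2 : toℕ v₂ ≡ 2
    ≡2 = toℕ-vertex _
    ≡3 : toℕ v₃ ≡ 3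
    ≡3 = toℕ-vertex _

    differ : ∀ {i j : Fin n} {l m} → toℕ i ≡ l → toℕ j ≡ m → l ≢ m → i ≢ j
    differ i≡l j≡m l≢m refl = l≢m (trans (sym i≡l) j≡m)

    01-adjacent : adj S v₀ v₁ ≡ true
    01-adjacent = S-small (subst₂ SmallEdge (sym ≡0) (sym ≡1) 01-edge) (differ ≡0 ≡1 λ ())

    23-adjacent : adj S v₂ v₃ ≡ true
    23-adjacent = S-small (subst₂ SmallEdge (sym ≡2) (sym ≡3) 23-edge) (differ ≡2 ≡3 λ ())

    -- Away from its stem the row of a leaf is already `α`, so the leaf becomes free once that
    -- single edge is traded away.
    record Leaf (u : Fin n) : Set where
      field
        stem     : Fin n
        u<w      : toℕ u < w
        stem<w   : toℕ stem < w
        attached : adj S u stem ≡ true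
        only     : ∀ v → v ≢ stem → adj S u v ≡ α v

    leaf : ∀ {u s l m} → toℕ u ≡ l → toℕ s ≡ m → l < 4 → m < 4 → adj S u s ≡ true →
           (∀ {r} → SmallEdge l r ⊎ SmallEdge r l → r ≡ m) → Leaf u
    leaf {u} {s} {l} {m} u≡l s≡m l<4 m<4 us unique = record
      { stem = s ; u<w = <w u≡l l<4 ; stem<w = <w s≡m m<4 ; attached = us
      ; only = S-row u (_≢ s) (<-trans (<w u≡l l<4) w<N) none }
      where
      <w : ∀ {i : Fin n} {l} → toℕ i ≡ l → l < 4 → toℕ i < w
      <w refl l<4 = <-≤-trans l<4 (≤-trans (m≤m+n 4 4) (m≤m+n 8 q))
      u<4 : toℕ u < 4
      u<4 = subst (_< 4) (sym u≡l) l<4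
      small : ∀ {v} → v ≢ s → ¬ (SmallEdge (toℕ u) (toℕ v) ⊎ SmallEdge (toℕ v) (toℕ u))
      small {v} v≢s e = v≢s (Fin.toℕ-injective (trans
        (unique (subst (λ l → SmallEdge l (toℕ v) ⊎ SmallEdge (toℕ v) l) u≡l e)) (sym s≡m)))
      none : ∀ v → toℕ v < N → v ≢ s → ¬ (Upper N q (toℕ u) (toℕ v) ⊎ Upper N q (toℕ v) (toℕ u))
      none v v<N v≢s (inj₁ (inj₁ (inj₁ N≤u)))         = <⇒≱ (<-trans (<w u≡l l<4) w<N) N≤u
      none v v<N v≢s (inj₁ (inj₁ (inj₂ e)))           = small v≢s (inj₁ e)
      none v v<N v≢s (inj₁ (inj₂ ((4≤u , _) , _)))    = <⇒≱ u<4 4≤u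
      none v v<N v≢s (inj₂ (inj₁ (inj₁ N≤v)))         = <⇒≱ v<N N≤v
      none v v<N v≢s (inj₂ (inj₁ (inj₂ e)))           = small v≢s (inj₂ e)
      none v v<N v≢s (inj₂ (inj₂ (_ , (8≤u , _))))    = <⇒≱ u<4 (≤-trans (m≤m+n 4 4) 8≤u)

    leaf₀ : Leaf v₀
    leaf₀ = leaf ≡0 ≡1 (m≤m+n 1 3) (m≤m+n 2 2) 01-adjacent λ { (inj₁ 01-edge) → refl }
    leaf₁ : Leaf v₁
    leaf₁ = leaf ≡1 ≡0 (m≤m+n 2 2) (m≤m+n 1 3) (flip-adj S 01-adjacent) λ { (inj₂ 01-edge) → refl }
    leaf₂ : Leaf v₂
    leaf₂ = leaf ≡2 ≡3 (m≤m+n 3 1) ≤-refl 23-adjacent λ { (inj₁ 23-edge) → refl }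

    -- This is the use of having three leaves: the two ends of an edge cannot hit all of them.
    leaf-off : ∀ f₁ f₂ → ∃[ u ] Leaf u × u ≢ f₁ × u ≢ f₂
    leaf-off f₁ f₂ = case off-pair f₁ f₂ (differ ≡0 ≡1 λ ()) (differ ≡0 ≡2 λ ()) (differ ≡1 ≡2 λ ()) of λ where
      (inj₁ off)        → v₀ , leaf₀ , off
      (inj₂ (inj₁ off)) → v₁ , leaf₁ , off
      (inj₂ (inj₂ off)) → v₂ , leaf₂ , off

    Hooked : Set
    Hooked = ∃[ x ] ∃[ i ] toℕ x < N × (w ≤ toℕ i × toℕ i < N) × adj b x i ≡ true

    hooked? : Dec Hooked
    hooked? = Fin.any? λ x → Fin.any? λ i → (toℕ x <? N) ×-dec ((w ≤? toℕ i) ×-dec (toℕ i <? N)) ×-dec (adj b x i Bool.≟ true)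

    -- Trading a pendant edge of S for a new edge of B frees its leaf.
    hooked : Hooked
    hooked = case hooked? of λ where
        (yes h) → h
        (no ¬h) → let
            e , b∋e , S∌e = new-element S b (≤-trans (≤-reflexive (cong suc ∣S∣≡t)) (≤-trans t<k (≤-reflexive (sym (proj₂ B)))))
            f₁ , f₂ , f₁≢f₂ , e≡f = label-surjective e
            u , L , u≢f₁ , u≢f₂ = leaf-off f₁ f₂
          in contradiction
            (trade ¬h f₁≢f₂ (trans (adj-label b f₁≢f₂) (trans (cong (lookup b) (sym e≡f)) b∋e))
              (trans (adj-label S f₁≢f₂) (trans (cong (lookup S) (sym e≡f)) S∌e)) L u≢f₁ u≢f₂) ¬h
      where
      module _ (¬h : ¬ Hooked) {f₁ f₂} (f₁≢f₂ : f₁ ≢ f₂) (bf : adj b f₁ f₂ ≡ true) (Sf : adj S f₁ f₂ ≡ false)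
               {u} (L : Leaf u) (u≢f₁ : u ≢ f₁) (u≢f₂ : u ≢ f₂) where
        open Leaf L
        <N : ∀ {f g} → f ≢ g → adj S f g ≡ false → toℕ f < N
        <N f≢g Sfg = ≰⇒> λ N≤f → contradiction (trans (sym (S-outer N≤f f≢g)) Sfg) λ ()
        f₁<N = <N f₁≢f₂ Sf
        f₂<N = <N (f₁≢f₂ ∘ sym) (flip-adj S Sf)
        -- The new edge is missing from `S`, so both its ends are inner. As nothing is hooked, they
        -- lie below `w`, and the trade leaves the far vertices free.
        f₁<w : toℕ f₁ < w
        f₁<w = ≰⇒> λ w≤f₁ → ¬h (f₂ , f₁ , f₂<N , (w≤f₁ , f₁<N) , flip-adj b bf)
        f₂<w : toℕ f₂ < w
        f₂<w = ≰⇒> λ w≤f₂ → ¬h (f₁ , f₂ , f₁<N , (w≤f₂ , f₂<N) , bf)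
        u≢s : u ≢ stem
        u≢s = adj⇒≢ S attached
        G : Subset (n C 2)
        G = rewire S u≢s f₁≢f₂
        G-far : ∀ p → w ≤ toℕ p → toℕ p < N → F G p
        G-far p w≤p p<N v = trans (adj-rewire-else S u≢s f₁≢f₂ p (≢p u<w) (≢p stem<w) (≢p f₁<w) (≢p f₂<w) v) (far-free p w≤p p<N v)
          where
          ≢p : ∀ {i : Fin n} → toℕ i < w → p ≢ i
          ≢p i<w = <⇒≢ᶠ (<-≤-trans i<w w≤p) ∘ sym
        G-u : F G u
        G-u v = case v Fin.≟ stem of λ where
          (yes v≡s) → subst (λ v → adj G u v ≡ α v) (sym v≡s)
            (trans (adj-rewire-out S u≢s f₁≢f₂ attached Sf) (sym (α-inner (<-trans stem<w w<N))))
          (no v≢s)  → trans (adj-rewire-at S u≢s f₁≢f₂ attached Sf u≢f₁ u≢f₂ v v≢s) (only v v≢s)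
        i₀ : Fin n
        i₀ = ι zero
        i₀<N : toℕ i₀ < N
        i₀<N = ι<N zero
        w≤i₀ : w ≤ toℕ i₀
        w≤i₀ = ≤-trans (n≤1+n w) (≤-trans (m≤m+n w′ w′) (≤ι zero))
        -- The edge from `u` to its stem is gone from `G` but still in `b`. Since `u` is free in
        -- `G`, it is a twin of `i₀`, which inherits the edge to the stem.
        hook : adj b stem i₀ ≡ true
        hook = twins-in G (trans (∣rewire∣ S u≢s f₁≢f₂ attached Sf) ∣S∣≡t) (rewire-⊑ S u≢s f₁≢f₂ b S⊑B bf)
          (λ p w′+w′≤p → G-far p (≤-trans (n≤1+n w) (≤-trans (m≤m+n w′ w′) w′+w′≤p)))
          G-u (G-far i₀ w≤i₀ i₀<N) (u≢s ∘ sym) (<⇒≢ᶠ (<-≤-trans stem<w w≤i₀))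
          (flip-adj b (adj-⊑ S b S⊑B u stem attached))
        trade : Hooked
        trade = stem , i₀ , <-trans stem<w w<N , (w≤i₀ , i₀<N) , hook

    Hub : Fin n → Set
    Hub x = toℕ x < w′ × (∀ p → w′ ≤ toℕ p → toℕ p < N → adj b x p ≡ true)

    -- A hooked vertex below `w` is joined to all far vertices, as these are twins. If the hooked
    -- vertex is itself far, then any two far vertices are joined, and vertex `w` serves as hub.
    hub : ∃[ x ] Hub x
    hub = case hooked of λ { (x , i , x<N , (w≤i , i<N) , xi) → case w ≤? toℕ x of λ where
      (no w≰x) → x , <-trans (≰⇒> w≰x) (n<1+n w) , λ p w′≤p p<N →
        far-twins w≤i i<N (<⇒≤ w′≤p) p<N (<⇒≢ᶠ (<-≤-trans (≰⇒> w≰x) w≤i))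
          (<⇒≢ᶠ (<-trans (≰⇒> w≰x) w′≤p)) xi
      (yes w≤x) → let
          x₀ = vertex w<N
          x₀≡w = toℕ-vertex w<N
          w≤x₀ = ≤-reflexive (sym x₀≡w)
          x₀<N = subst (_< N) (sym x₀≡w) w<N
          x~ = λ p w≤p p<N x≢p → far-twins {x} {i} {p} w≤i i<N w≤p p<N (adj⇒≢ b xi) x≢p xi
        in x₀ , subst (_< w′) (sym x₀≡w) ≤-refl , λ p w′≤p p<N →
          let x₀≢p = <⇒≢ᶠ (≤-trans (s≤s (≤-reflexive x₀≡w)) w′≤p) in case p Fin.≟ x of λ where
            (yes refl) → flip-adj b (x~ x₀ w≤x₀ x₀<N (x₀≢p ∘ sym))
            (no p≢x)   → flip-adj b (far-twins w≤x x<N w≤x₀ x₀<N p≢x (x₀≢p ∘ sym)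
                           (flip-adj b (x~ p (<⇒≤ w′≤p) p<N (p≢x ∘ sym)))) }

  module _ {x : Fin n} (hub-x : Hub x) {y : Fin n} (y<w′ : toℕ y < w′) (y≢x : y ≢ x) where

    private
      -- Loop invariant after treating the vertices below `j` as possible neighbours of `y`: only
      -- the numbers from `w′` up to, but excluding, `w′ + j` may have received a new edge from `x`.
      record Freed (j : ℕ) : Set where
        field
          G      : Subset (n C 2)
          ∣G∣    : ∣ G ∣ ≡ t
          G⊑b    : G ⊑ b
          unused : ∀ p → w′ + j ≤ toℕ p → toℕ p < N → F G p
          near   : ∀ u → toℕ u < j → adj G y u ≡ false
          rest   : ∀ u → w′ ≤ toℕ u → adj G y u ≡ α u

      start : Freed 0
      start = record
        { G = S ; ∣G∣ = ∣S∣≡t ; G⊑b = S⊑B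
        ; unused = λ p w′≤p → far-free p (≤-trans (n≤1+n w) (≤-trans (m≤m+n w′ 0) w′≤p))
        ; near = λ _ ()
        ; rest = λ u w′≤u → case N ≤? toℕ u of λ where
            (yes N≤u) → trans (flip-adj S (S-outer N≤u (y≢ w′≤u ∘ sym))) (sym (α-outer N≤u))
            (no N≰u)  → trans (flip-adj S (trans (far-free u (<⇒≤ w′≤u) (≰⇒> N≰u) y) (α-inner (<-trans y<w′ w′<N)))) (sym (α-inner (≰⇒> N≰u)))
        }
        where
        y≢ : ∀ {u} → w′ ≤ toℕ u → y ≢ u
        y≢ w′≤u = <⇒≢ᶠ (<-≤-trans y<w′ w′≤u)

      next : ∀ {j} → j < w′ → Freed j → Freed (suc j)
      next {j} j<w′ P = case adj G y u Bool.≟ true of λ where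
          (yes yu) → exchanged yu
          (no ¬yu) → record
            { G = G ; ∣G∣ = ∣G∣ ; G⊑b = G⊑b
            ; unused = λ p w′+j<p → unused p (≤-trans (+-monoʳ-≤ w′ (n≤1+n j)) w′+j<p)
            ; near = λ v v≤j → extend v v≤j (Bool.¬-not ¬yu) (near v)
            ; rest = rest }
        where
        open Freed P
        u : Fin n
        u = vertex (<-trans j<w′ w′<N)
        u≡j : toℕ u ≡ j
        u≡j = toℕ-vertex (<-trans j<w′ w′<N)
        u<w′ : toℕ u < w′
        u<w′ = subst (_< w′) (sym u≡j) j<w′
        extend : ∀ {G′ : Subset (n C 2)} v → toℕ v < suc j → adj G′ y u ≡ false → (toℕ v < j → adj G′ y v ≡ false) → adj G′ y v ≡ false
        extend {G′} v v≤j yu old = case v Fin.≟ u of λ where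
          (yes v≡u) → subst (λ v → adj G′ y v ≡ false) (sym v≡u) yu
          (no v≢u)  → old (≤∧≢⇒< (s≤s⁻¹ v≤j) λ v≡j → v≢u (Fin.toℕ-injective (trans v≡j (sym u≡j))))
        c<N : w′ + j < N
        c<N = <-≤-trans (+-monoʳ-< w′ j<w′) w′+w′≤N
        -- A fresh vertex, still free in `G` and hence not joined to `x` there, although the hub
        -- property puts this edge into `b`. As `y` is neither `x` nor `c`, the trade adds no edge
        -- at `y`.
        c : Fin n
        c = vertex c<N
        c≡ : toℕ c ≡ w′ + j
        c≡ = toℕ-vertex c<N
        w′≤c : w′ ≤ toℕ c
        w′≤c = ≤-trans (m≤m+n w′ j) (≤-reflexive (sym c≡))
        c<N′ : toℕ c < N
        c<N′ = subst (_< N) (sym c≡) c<N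
        x≢c : x ≢ c
        x≢c = <⇒≢ᶠ (<-≤-trans (proj₁ hub-x) w′≤c)
        y≢c : y ≢ c
        y≢c = <⇒≢ᶠ (<-≤-trans y<w′ w′≤c)
        xc-absent : adj G x c ≡ false
        xc-absent = flip-adj G (trans (unused c (≤-reflexive (sym c≡)) c<N′ x) (α-inner (<-trans (proj₁ hub-x) w′<N)))
        module _ (yu : adj G y u ≡ true) where
          y≢u : y ≢ u
          y≢u = adj⇒≢ G yu
          G′ : Subset (n C 2)
          G′ = rewire G y≢u x≢c
          exchanged : Freed (suc j)
          exchanged = record
            { G = G′
            ; ∣G∣ = trans (∣rewire∣ G y≢u x≢c yu xc-absent) ∣G∣
            ; G⊑b = rewire-⊑ G y≢u x≢c b G⊑b (proj₂ hub-x c w′≤c c<N′)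
            ; unused = λ p w′+j<p p<N v →
                let c<p = ≤-trans (≤-reflexive (trans (cong suc c≡) (sym (+-suc w′ j)))) w′+j<p
                    ≢p = λ {i : Fin n} (i<w′ : toℕ i < w′) → <⇒≢ᶠ (<-≤-trans i<w′ (≤-trans w′≤c (<⇒≤ c<p))) ∘ sym
                in trans (adj-rewire-else G y≢u x≢c p (≢p y<w′) (≢p u<w′) (≢p (proj₁ hub-x)) (<⇒≢ᶠ c<p ∘ sym) v)
                         (unused p (≤-trans (+-monoʳ-≤ w′ (n≤1+n j)) w′+j<p) p<N v)
            ; near = λ v v≤j → extend v v≤j (adj-rewire-out G y≢u x≢c yu xc-absent) λ v<j →
                trans (row v λ v≡u → <-irrefl (trans (cong toℕ v≡u) u≡j) v<j) (near v v<j)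
            ; rest = λ v w′≤v → trans (row v (<⇒≢ᶠ (<-≤-trans u<w′ w′≤v) ∘ sym)) (rest v w′≤v)
            }
            where
            row : ∀ v → v ≢ u → adj G′ y v ≡ adj G y v
            row = adj-rewire-at G y≢u x≢c yu xc-absent y≢x y≢c

      freed : ∀ j → j ≤ w′ → Freed j
      freed zero    _    = start
      freed (suc j) j<w′ = next j<w′ (freed j (<⇒≤ j<w′))

    -- Edges at y are traded, one by one, for edges from the hub x.
    near-twins : ∃[ G ] ∣ G ∣ ≡ t × G ⊑ b × FarFree G × F G y
    near-twins = G , ∣G∣ , G⊑b , unused , λ u → case toℕ u <? w′ of λ where
        (yes u<w′) → trans (near u u<w′) (sym (α-inner (<-trans u<w′ w′<N)))
        (no u≮w′)  → rest u (≮⇒≥ u≮w′)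
      where open Freed (freed w′ ≤-refl)

  private
    module _ {x : Fin n} (hub-x : Hub x) where

      -- Below `w′` the vertex `y` is free in the traded graph of `near-twins`; from `w′` on it is
      -- free in `S` itself.
      twins-of-far : ∀ {y} → toℕ y < N → y ≢ x → ∀ i →
        (∀ u → u ≢ y → u ≢ ι i → adj b u y ≡ true → adj b u (ι i) ≡ true) ×
        (∀ u → u ≢ y → u ≢ ι i → adj b u (ι i) ≡ true → adj b u y ≡ true)
      twins-of-far {y} y<N y≢x i = case toℕ y <? w′ of λ where
          (yes y<w′) → let G , ∣G∣ , G⊑b , far , free-y = near-twins hub-x y<w′ y≢x
                           free-i = far (ι i) (≤ι i) (ι<N i) in
            (λ _ → twins-in G ∣G∣ G⊑b far free-y free-i) ,
            λ _ u≢y u≢i → twins-in G ∣G∣ G⊑b far free-i free-y u≢i u≢y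
          (no y≮w′) → let w≤y = <⇒≤ (≮⇒≥ y≮w′) in
            (λ _ → far-twins w≤y y<N w≤i (ι<N i)) ,
            λ _ u≢y u≢i → far-twins w≤i (ι<N i) w≤y y<N u≢i u≢y
        where
        w≤i : w ≤ toℕ (ι i)
        w≤i = ≤-trans (n≤1+n w) (≤-trans (m≤m+n w′ w′) (≤ι i))

      i₀ i₁ : Fin n
      i₀ = ι zero
      i₁ = ι (suc zero)

      i₀≢i₁ : i₀ ≢ i₁
      i₀≢i₁ eq = contradiction (ι-injective eq) λ ()

      w′≤ι : ∀ i → w′ ≤ toℕ (ι i)
      w′≤ι i = ≤-trans (m≤m+n w′ w′) (≤ι i)

      ≢ι : ∀ {u} i → toℕ u < w′ → u ≢ ι i
      ≢ι i u<w′ = <⇒≢ᶠ (<-≤-trans u<w′ (w′≤ι i))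

      x~ : ∀ {y} → toℕ y < N → y ≢ x → adj b x y ≡ true
      x~ {y} y<N y≢x = proj₂ (twins-of-far y<N y≢x zero) _ (y≢x ∘ sym) (≢ι zero (proj₁ hub-x))
        (proj₂ hub-x i₀ (w′≤ι zero) (ι<N zero))

      module _ {p r : Fin n} (p<w′ : toℕ p < w′) (r<w′ : toℕ r < w′) (p≢x : p ≢ x) (r≢x : r ≢ x) (pr : adj b p r ≡ true) where

        -- An edge off the hub spreads along twins: replacing first `r` and then `p` by far vertices
        -- gives `i₀~i₁`, and replacing these in turn by arbitrary inner vertices gives `inner`.
        p~ι : ∀ i → adj b p (ι i) ≡ true
        p~ι i = proj₁ (twins-of-far (<-trans r<w′ w′<N) r≢x i) _ (adj⇒≢ b pr) (≢ι i p<w′) pr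

        i₀~i₁ : adj b i₀ i₁ ≡ true
        i₀~i₁ = proj₁ (twins-of-far (<-trans p<w′ w′<N) p≢x (suc zero)) _ (≢ι zero p<w′ ∘ sym) i₀≢i₁ (flip-adj b (p~ι zero))

        i₀~ : ∀ {z} → toℕ z < N → z ≢ x → z ≢ i₀ → adj b i₀ z ≡ true
        i₀~ z<N z≢x z≢i₀ = proj₂ (twins-of-far z<N z≢x (suc zero)) _ (z≢i₀ ∘ sym) i₀≢i₁ i₀~i₁

        inner : ∀ {y z} → toℕ y < N → toℕ z < N → y ≢ z → adj b y z ≡ true
        inner {y} {z} y<N z<N y≢z = case (y Fin.≟ x) ,′ (z Fin.≟ x) ,′ (y Fin.≟ i₀) ,′ (z Fin.≟ i₀) of λ where
          (yes refl , _ , _ , _)                 → x~ z<N (y≢z ∘ sym)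
          (no _ , yes refl , _ , _)              → flip-adj b (x~ y<N y≢z)
          (no _ , no z≢x , yes refl , _)         → i₀~ z<N z≢x (y≢z ∘ sym)
          (no y≢x , no _ , no _ , yes refl)      → flip-adj b (i₀~ y<N y≢x y≢z)
          (no y≢x , no z≢x , no y≢i₀ , no z≢i₀) → proj₂ (twins-of-far z<N z≢x zero) _ y≢z y≢i₀ (flip-adj b (i₀~ y<N y≢x y≢i₀))

        complete : ∀ e → b ∋ e
        complete e with y , z , y≢z , refl ← label-surjective e = trans (sym (adj-label b y≢z)) (case (toℕ y <? N) ,′ (toℕ z <? N) of λ where
          (no y≮N , _)        → b-outer (≮⇒≥ y≮N) y≢z
          (yes _ , no z≮N)    → flip-adj b (b-outer (≮⇒≥ z≮N) (y≢z ∘ sym))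
          (yes y<N , yes z<N) → inner y<N z<N y≢z)

        impossible : ⊥
        impossible = <⇒≱ k<v (≤-trans (≤-reflexive (sym (∣⊤∣≡n (n C 2))))
          (≤-trans (⊑⇒∣∣≤ full b (λ e _ → complete e)) (≤-reflexive (proj₂ B))))

  -- The hub lies on at most one of the two isolated edges, and the other one is an edge off the
  -- hub.
  no-such-block : ⊥
  no-such-block = case hub of λ { (x , hub-x) → case (v₀ Fin.≟ x) ,′ (v₁ Fin.≟ x) of λ where
      (no v₀≢x , no v₁≢x)  → impossible hub-x {v₀} {v₁} (<w′ ≡0 (s≤s z≤n)) (<w′ ≡1 (s≤s (s≤s z≤n))) v₀≢x v₁≢x (adj-⊑ S b S⊑B v₀ v₁ 01-adjacent)
      (yes refl , _)       → off-01 hub-x (differ ≡2 ≡0 λ ()) (differ ≡3 ≡0 λ ())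
      (_ , yes refl)       → off-01 hub-x (differ ≡2 ≡1 λ ()) (differ ≡3 ≡1 λ ()) }
    where
    <w′ : ∀ {i : Fin n} {l} → toℕ i ≡ l → l < w′ → toℕ i < w′
    <w′ refl l<w′ = l<w′
    off-01 : ∀ {x} → Hub x → v₂ ≢ x → v₃ ≢ x → ⊥
    off-01 hub-x v₂≢x v₃≢x = impossible hub-x {v₂} {v₃} (<w′ ≡2 (s≤s (s≤s (s≤s z≤n)))) (<w′ ≡3 (s≤s (s≤s (s≤s (s≤s z≤n))))) v₂≢x v₃≢x (adj-⊑ S b S⊑B v₂ v₃ 23-adjacent)

-- The choice of the threshold and the bound on the number of vertices.

crossing : ∀ {P : ℕ → Set} (P? : ∀ m → Dec (P m)) n → P n → ¬ P 0 →
           ∃[ m ] m < n × P (suc m) × ¬ P m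
crossing P? zero    P0   ¬P0 = contradiction P0 ¬P0
crossing P? (suc n) P1+n ¬P0 with P? n
... | no ¬Pn = n , ≤-refl , P1+n , ¬Pn
... | yes Pn with m , m<n , P1+m , ¬Pm ← crossing P? n Pn ¬P0 = m , m≤n⇒m≤1+n m<n , P1+m , ¬Pm

2*nC2≤n² : ∀ n → n C 2 + n C 2 ≤ n * n
2*nC2≤n² zero    = z≤n
2*nC2≤n² (suc n) = begin
  suc n C 2 + suc n C 2       ≡⟨ cong (λ c → c + c) (trans (sym (nCk+nC[k+1]≡[n+1]C[k+1] n 1)) (cong (_+ n C 2) (nC1≡n n))) ⟩
  (n + n C 2) + (n + n C 2)   ≡⟨ regroup n (n C 2) ⟩
  (n + n) + (n C 2 + n C 2)   ≤⟨ +-monoʳ-≤ (n + n) (2*nC2≤n² n) ⟩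
  (n + n) + n * n             ≤⟨ n≤1+n _ ⟩
  suc ((n + n) + n * n)       ≡⟨ square n ⟩
  suc n * suc n               ∎
  where
  open ≤-Reasoning
  regroup : ∀ n c → (n + c) + (n + c) ≡ (n + n) + (c + c)
  regroup = solve-∀
  square : ∀ n → suc ((n + n) + n * n) ≡ suc n * suc n
  square = solve-∀

-- Doubling lets the quotient `h = N / 4` be bounded by `h * 4 ≤ N`. What remains is
-- `48 + 2 * lam ≤ 7 * lam + 44`, that is, `4 ≤ 5 * lam`.
class-size : ∀ {lam N} → 1 ≤ lam → 7 * lam + 43 < N →
             (9 + suc (N / 4)) + (9 + suc (N / 4)) + (4 + lam) ≤ N
class-size {lam} {N} 1≤lam 7λ+43<N = *-cancelˡ-≤ 2 (begin
  2 * ((9 + suc h) + (9 + suc h) + (4 + lam)) ≡⟨ collect h lam ⟩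
  4 + (44 + 2 * lam + h * 4)                  ≤⟨ +-monoˡ-≤ _ (≤-trans (m≤m+n 4 1) (*-monoʳ-≤ 5 1≤lam)) ⟩
  5 * lam + (44 + 2 * lam + h * 4)            ≡⟨ regroup h lam ⟩
  suc (7 * lam + 43) + h * 4                  ≤⟨ +-mono-≤ 7λ+43<N (m/n*n≤m N 4) ⟩
  N + N                                       ≡⟨ cong (N +_) (+-identityʳ N) ⟨
  2 * N                                       ∎)
  where
  open ≤-Reasoning
  h = N / 4
  collect : ∀ h l → 2 * ((9 + suc h) + (9 + suc h) + (4 + l)) ≡ 4 + (44 + 2 * l + h * 4)
  collect = solve-∀
  regroup : ∀ h l → 5 * l + (44 + 2 * l + h * 4) ≡ suc (7 * l + 43) + h * 4
  regroup = solve-∀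

few-vertices : ∀ {n t k lam} (D : Design t (n C 2) k lam) → Design.Nontrivial D → Graphical {n} D →
               2 ≤ t → ∀ M → 7 * lam + 43 ≤ M → n < M + M
few-vertices {n} {t} {k} {lam} D nontrivial@(t<k , k<v , _) graphical 2≤t M 7λ+43≤M = ≰⇒> impossible
  where
  open Design D using (1≤lam)

  2t<v : t + t < n C 2
  2t<v = ≤-<-trans (+-monoˡ-≤ t (<⇒≤ t<k)) (nontrivial⇒k+t<v D nontrivial)

  impossible : M + M ≤ n → ⊥
  impossible M+M≤n = let
      -- The condition holds at `n`, where no edge is outer, and fails at 0, where all edges are
      -- outer and outnumber `t`. The threshold is a point where it turns true.
      N₀ , N≤n , 2+outer≤t , 2+outer₀≰t = crossing (λ m → 2 + ∣ outer n m ∣ ≤? t) n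
        (≤-trans (≤-reflexive (cong (2 +_) (∣outer-n∣ n))) 2≤t)
        (λ 2+outer≤t → <⇒≱ (<-trans t<k k<v) (≤-trans (∣outer-0∣ n) (≤-trans (m≤n+m _ 2) 2+outer≤t)))
    in finish M+M≤n N≤n 2+outer≤t 2+outer₀≰t
    where
    module _ (M+M≤n : M + M ≤ n) {N₀} (N≤n : suc N₀ ≤ n)
             (2+outer≤t : 2 + ∣ outer n (suc N₀) ∣ ≤ t) (2+outer₀≰t : ¬ 2 + ∣ outer n N₀ ∣ ≤ t) where
      open ≤-Reasoning
      N = suc N₀
      a = ∣ outer n N ∣
      h = N / 4
      -- One above the quotient, so that the `4 * q` spokes number at least `N` and can make up all
      -- missing edges.
      q = suc h

      -- Failure at `N₀` means `t < 2 + N₀ + a` after `∣outer∣-step`; strictness turns `2 + N₀` into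
      -- `N`.
      t≤N+a : t ≤ N + a
      t≤N+a = s≤s⁻¹ (≤-trans (≰⇒> 2+outer₀≰t) (+-monoʳ-≤ 2 (∣outer∣-step n N₀ N≤n)))

      -- Otherwise at least half of all edges would be outer, and `t` would be at least half of
      -- `n C 2`.
      n<N+N : n < N + N
      n<N+N = ≰⇒> λ N+N≤n → <⇒≱ 2t<v (≤-trans (∣outer∣-half n N N+N≤n) (+-mono-≤ a≤t a≤t))
        where
        a≤t : a ≤ t
        a≤t = ≤-trans (m≤n+m a 2) 2+outer≤t

      M<N : M < N
      M<N = ≰⇒> λ N≤M → <⇒≱ n<N+N (≤-trans (+-mono-≤ N≤M N≤M) M+M≤n)

      room : (9 + q) + (9 + q) + (4 + lam) ≤ N
      room = class-size 1≤lam (≤-trans (s≤s 7λ+43≤M) M<N)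

      N≤4q : N ≤ 4 * q
      N≤4q = begin
        N                 ≡⟨ m≡m%n+[m/n]*n N 4 ⟩
        N % 4 + h * 4     ≤⟨ +-monoˡ-≤ (h * 4) (<⇒≤ (m%n<n N 4)) ⟩
        4 + h * 4         ≡⟨ *-comm q 4 ⟩
        4 * q             ∎

      8+q≤N : 8 + q ≤ N
      8+q≤N = begin
        8 + q                               ≤⟨ n≤1+n _ ⟩
        9 + q                               ≤⟨ m≤m+n (9 + q) (9 + q) ⟩
        (9 + q) + (9 + q)                   ≤⟨ m≤m+n _ (4 + lam) ⟩
        (9 + q) + (9 + q) + (4 + lam)       ≤⟨ room ⟩
        N                                   ∎

      finish : ⊥
      finish = let
          S , lower⊑S , S⊑upper , ∣S∣≡t = between (lower n N) (upper n N q) t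
            (graph-⊑ n (lower? N) (upper? N q) inj₁)
            (≤-trans (∣lower∣ n N≤n (≤-trans (m≤m+n 4 (4 + q)) 8+q≤N)) 2+outer≤t)
            (≤-trans t≤N+a (≤-trans (+-monoˡ-≤ a N≤4q) (∣upper∣ n N≤n q 8+q≤N)))
          B , B∈blocks , S⊑B = covering-block {n} D 1≤lam S ∣S∣≡t
        in no-such-block {n} D graphical t<k k<v N q N≤n room {S} ∣S∣≡t lower⊑S S⊑upper {B} B∈blocks S⊑B

-- The numerical bounds on t, n and k.

doubled-square : ∀ m → (m + m) * (m + m) ≡ 2 * (2 * (m * (m * 1)))
doubled-square = solve-∀

ten-doubled : ∀ m → 10 * (m + m) ≡ 20 * (m * 1)
ten-doubled = solve-∀

theorem5p7 : (lam : ℕ) → 1 ≤ lam →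
    ∀ (n t k : ℕ) (D : Design t (n C 2) k lam) →
    Design.Nontrivial D → Graphical {n} D → 2 ≤ t →
    (10 * t < 23 * T lam ^ 2) ×
    (10 * n < 47 * T lam ^ 2) ×
    (10 * k < 111 * T lam ^ 4)
theorem5p7 lam _ n t k D nontrivial@(t<k , k<v , _) graphical 2≤t =
  bounds (T lam) (m≤n⊔m (10 ^ 5) (7 * lam + 43))
  where
  open ≤-Reasoning
  bounds : ∀ M → 7 * lam + 43 ≤ M → (10 * t < 23 * M ^ 2) × (10 * n < 47 * M ^ 2) × (10 * k < 111 * M ^ 4)
  bounds M 7λ+43≤M = t-bound , n-bound , k-bound
    where
    n<2M : n < M + M
    n<2M = few-vertices D nontrivial graphical 2≤t M 7λ+43≤M
    instance
      M≢0 : NonZero M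
      M≢0 = >-nonZero (≤-trans (m≤n+m 1 (7 * lam + 42)) (≤-trans (≤-reflexive (+-assoc (7 * lam) 42 1)) 7λ+43≤M))
    -- As `t < k < n C 2`, this one estimate serves for both `t` and `k`.
    nC2≤2M² : n C 2 ≤ 2 * M ^ 2
    nC2≤2M² = *-cancelˡ-≤ 2 (begin
      2 * (n C 2)          ≡⟨ cong (n C 2 +_) (+-identityʳ (n C 2)) ⟩
      n C 2 + n C 2        ≤⟨ 2*nC2≤n² n ⟩
      n * n                ≤⟨ *-mono-≤ (<⇒≤ n<2M) (<⇒≤ n<2M) ⟩
      (M + M) * (M + M)    ≡⟨ doubled-square M ⟩
      2 * (2 * M ^ 2)      ∎)
    10*nC2≤20M² : 10 * (n C 2) ≤ 20 * M ^ 2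
    10*nC2≤20M² = ≤-trans (*-monoʳ-≤ 10 nC2≤2M²) (≤-reflexive (sym (*-assoc 10 2 (M ^ 2))))
    t-bound : 10 * t < 23 * M ^ 2
    t-bound = begin-strict
      10 * t       <⟨ *-monoʳ-< 10 (<-trans t<k k<v) ⟩
      10 * (n C 2) ≤⟨ 10*nC2≤20M² ⟩
      20 * M ^ 2   ≤⟨ *-monoˡ-≤ (M ^ 2) (m≤m+n 20 3) ⟩
      23 * M ^ 2   ∎
    n-bound : 10 * n < 47 * M ^ 2
    n-bound = begin-strict
      10 * n         <⟨ *-monoʳ-< 10 n<2M ⟩
      10 * (M + M)   ≡⟨ ten-doubled M ⟩
      20 * M ^ 1     ≤⟨ *-mono-≤ (m≤m+n 20 27) (^-monoʳ-≤ M (n≤1+n 1)) ⟩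
      47 * M ^ 2     ∎
    k-bound : 10 * k < 111 * M ^ 4
    k-bound = begin-strict
      10 * k         <⟨ *-monoʳ-< 10 k<v ⟩
      10 * (n C 2)   ≤⟨ 10*nC2≤20M² ⟩
      20 * M ^ 2     ≤⟨ *-mono-≤ (m≤m+n 20 91) (^-monoʳ-≤ M (m≤m+n 2 2)) ⟩
      111 * M ^ 4    ∎
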